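{- Let $n,k,l$ be integers with $k>0$, $l>\frac n2$ and $k+l<n$. Suppose that \[ \Bigl(1+\frac{n-k}{n-1}\Bigr)\frac{l-1}{n-1}<1 \quad\text{and}\quad (n-k)\sum_{i=n-l}^{n-2}\frac1i-(n-l)\sum_{i=k}^{n-2}\frac1i<0 . \] Then $M(n,k,l)=\binom{n-1}{k-1}\binom{n-1}{l-1}$. Moreover, if $\mathcal{A}\subset\binom{[n]}{k}$ and $\mathcal{B}\subset\binom{[n]}{l}$ are cross-intersecting families with $|\mathcal{A}||\mathcal{B}|=M(n,k,l)$, then there is $i\in[n]$ such that $\mathcal{A}=\{A\in\binom{[n]}{k}:i\in A\}$ and $\mathcal{B}=\{B\in\binom{[n]}{l}:i\in B\}$.
   Context: $[n]=\{1,\dots,n\}$ and $\binom{[n]}{k}$ is the set of $k$-element subsets of $[n]$. Families $\mathcal{A},\mathcal{B}$ are cross-intersecting if $A\cap B\ne\emptyset$ for all $A\in\mathcal{A},B\in\mathcal{B}$. $M(n,k,l)$ denotes the maximum of $|\mathcal{A}||\mathcal{B}|$ over cross-intersecting families $\mathcal{A}\subset\binom{[n]}{k}$, $\mathcal{B}\subset\binom{[n]}{l}$. -}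

module Defs where

open import Data.Bool using (Bool; true; false; T; if_then_else_)
open import Data.Nat using (ℕ; zero; suc; _∸_)
open import Data.List using (List; []; _∷_; [_]; _++_; map)
open import Data.Nat.ListAction using (sum)
open import Data.Vec using (Vec; []; _∷_)
open import Data.Fin.Subset using (Subset; inside; outside; _∈_; ∣_∣)
open import Data.Integer using (+_)
open import Data.Rational using (ℚ; 0ℚ; _/_; _+_)
open import Data.Product using (_×_; ∃-syntax)
open import Relation.Binary.PropositionalEquality using (_≡_)
open import Function.Bundles using (_⇔_)

allSubsets : (n : ℕ) → List (Subset n)
allSubsets zero = [ [] ]
allSubsets (suc n) = map (outside ∷_) (allSubsets n) ++ map (inside ∷_) (allSubsets n)

Family : ℕ → Set
Family n = Subset n → Bool

card : {n : ℕ} → Family n → ℕ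
card {n} 𝒜 = sum (map (λ A → if 𝒜 A then 1 else 0) (allSubsets n))

Uniform : {n : ℕ} → ℕ → Family n → Set
Uniform k 𝒜 = ∀ A → T (𝒜 A) → ∣ A ∣ ≡ k

CrossIntersecting : {n : ℕ} → Family n → Family n → Set
CrossIntersecting {n} 𝒜 ℬ =
  ∀ A B → T (𝒜 A) → T (ℬ B) → ∃[ x ] (x ∈ A × x ∈ B)

CommonStar : {n : ℕ} → ℕ → ℕ → Family n → Family n → Set
CommonStar {n} k l 𝒜 ℬ =
  ∃[ i ] ((∀ A → (T (𝒜 A) ⇔ (∣ A ∣ ≡ k × i ∈ A)))
        × (∀ B → (T (ℬ B) ⇔ (∣ B ∣ ≡ l × i ∈ B))))

-- a / b as a rational (only used with b ≥ 1; value 0 if b = 0)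
_over_ : ℕ → ℕ → ℚ
a over zero = 0ℚ
a over suc b = (+ a) / suc b

harmAux : ℕ → ℕ → ℚ
harmAux a zero = 0ℚ
harmAux a (suc c) = (1 over a) + harmAux (suc a) c

-- H a b = sum_{i=a}^{b} 1/i  (empty sum = 0 if b < a)
H : ℕ → ℕ → ℚ
H a b = harmAux a (suc b ∸ a)

{-# OPTIONS --safe #-}
module Submission where

open import Defs
open import Data.Bool using (Bool; true; false; T; not; _∧_; _∨_; if_then_else_)
open import Data.Bool.Properties using (T-∧; T-∨; T-≡)
open import Data.Empty using (⊥; ⊥-elim)
open import Data.Fin using (Fin; zero; suc)
open import Data.Fin.Subset using (Subset; inside; outside; _∈_; _∉_; _⊆_; ∣_∣; ∁; _-_)
open import Data.Fin.Subset.Properties using (drop-there; x∈p⇒∣p-x∣<∣p∣; x∈∁p⇒x∉p; x∉∁p⇒x∈p; ∣∁p∣≡n∸∣p∣; ∣p∣≤n; _∈?_)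
open import Data.List using (map; _++_)
open import Data.List.Properties using (map-++; map-∘)
open import Data.Nat hiding (∣_-_∣)
open import Data.Nat.Combinatorics using (_C_; nCk≡nC[n∸k]; nCn≡1; nCk+nC[k+1]≡[n+1]C[k+1])
open import Data.Nat.ListAction using (sum)
open import Data.Nat.ListAction.Properties using (sum-++)
open import Data.Nat.Properties
open import Data.Nat.Tactic.RingSolver using (solve-∀)
open import Data.Product using (Σ; _×_; _,_; proj₁; proj₂; ∃-syntax)
open import Data.Sum using (_⊎_; inj₁; inj₂)
open import Data.Unit using (⊤; tt)
open import Data.Vec using ([]; _∷_; lookup; here; there)
open import Data.Vec.Properties using ([]=⇒lookup; lookup⇒[]=)
open import Function using (_∘_; id)
open import Function.Bundles using (Equivalence; mk⇔)
open import Relation.Binary.Definitions using (tri<; tri≈; tri>)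
open import Relation.Binary.PropositionalEquality
open import Relation.Nullary using (yes; no; ¬_)

-- Let 𝒜ᶜ consist of the complements of the members of 𝒜.  The l-sets below 𝒜ᶜ do not belong to ℬ,
-- so by the Kruskal–Katona theorem the sizes of 𝒜 and ℬ are bounded by those of an initial
-- lexicographic segment and its largest cross-intersecting partner.  Put r = n - k - l and
-- p = (n-1) C (k-1).  Induction along the segment gives n r α β ≤ k l (1 - α - β) for the densities
-- α, β.  If |𝒜| ≤ p, then ℬ contains a full star, and this bound in the ground set without its
-- centre is enough, because k < l.  If |𝒜| > p, one fills up a second star, a third one, and so
-- on: the first hypothesis says that completing the second star makes the product smaller, and the
-- second hypothesis, together with the density bound, handles the sizes in between.
-- In the case of equality |𝒜| = p, hence 𝒜ᶜ has (n-1) C (n-k) members and the smallest possible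
-- shadow, which forces its members to avoid a common point.

-- Binomial coefficients

-- The constants in `n r α β ≤ k l (1 - α - β)` make a pair of full stars, with `α = k/n` and
-- `β = l/n`, a case of equality. For `k < l` the bound in the whole ground set is nevertheless too
-- weak: the stars are not a critical point of `α β` on the curve of equality, so the curve has
-- points close by with a larger product. Hence, in estimating the product, the bound is applied one
-- point down, to what remains after a star has been split off, while that star enters with its
-- exact size. The second hypothesis acts through its polynomial consequence
-- `(k-1)(l-1)(n-k) ≤ (n-l)(n-l-1)(n-k-1)`, whose general form passes on from each star to the next.

pascal : ∀ n k → suc n C suc k ≡ n C k + n C suc k
pascal n k = sym (nCk+nC[k+1]≡[n+1]C[k+1] n k)

C-pos : ∀ {n k} → k ≤ n → 0 < n C k
C-pos {n} {zero} _ = ≤-reflexive refl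
C-pos {suc n} {suc k} (s≤s k≤n) =
  subst (0 <_) (sym (pascal n k)) (≤-trans (C-pos k≤n) (m≤m+n _ _))

C-zero : ∀ {n k} → n < k → n C k ≡ 0
C-zero {zero} {suc k} _ = refl
C-zero {suc n} {suc k} (s≤s n<k) =
  trans (pascal n k) (cong₂ _+_ (C-zero n<k) (C-zero (m<n⇒m<1+n n<k)))

C-sym : ∀ k m → (k + m) C m ≡ (k + m) C k
C-sym k m = trans (nCk≡nC[n∸k] (m≤n+m m k)) (cong ((k + m) C_) (m+n∸n≡m k m))

absorb : ∀ n k → suc k * (suc n C suc k) ≡ suc n * (n C k)
absorb zero zero = refl
absorb zero (suc k) rewrite pascal 0 (suc k) = *-zeroʳ (suc (suc k))
absorb (suc n) zero rewrite pascal (suc n) 0 = begin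
  1 * (1 + suc n C 1)     ≡⟨ +-identityʳ _ ⟩
  1 + suc n C 1           ≡⟨ cong (1 +_) (sym (+-identityʳ _)) ⟩
  1 + 1 * (suc n C 1)     ≡⟨ cong (1 +_) (absorb n 0) ⟩
  1 + suc n * 1           ≡⟨⟩
  suc (suc n) * 1         ∎
  where open ≡-Reasoning
absorb (suc n) (suc k) = begin
  suc (suc k) * (suc (suc n) C suc (suc k))
    ≡⟨ cong (suc (suc k) *_) (pascal (suc n) (suc k)) ⟩
  suc (suc k) * (A + suc n C suc (suc k))
    ≡⟨ *-distribˡ-+ (suc (suc k)) A _ ⟩
  (A + suc k * A) + suc (suc k) * (suc n C suc (suc k))
    ≡⟨ cong₂ (λ u v → (A + u) + v) (absorb n k) (absorb n (suc k)) ⟩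
  (A + suc n * (n C k)) + suc n * (n C suc k)
    ≡⟨ +-assoc A _ _ ⟩
  A + (suc n * (n C k) + suc n * (n C suc k))
    ≡⟨ cong (A +_) (sym (*-distribˡ-+ (suc n) (n C k) (n C suc k))) ⟩
  A + suc n * (n C k + n C suc k)
    ≡⟨ cong (λ u → A + suc n * u) (sym (pascal n k)) ⟩
  suc (suc n) * A ∎
  where
  open ≡-Reasoning
  A = suc n C suc k

C-ratio : ∀ k m → suc k * ((k + m) C suc k) ≡ m * ((k + m) C k)
C-ratio k m = +-cancelˡ-≡ (suc k * Q) _ _ (begin
  suc k * Q + suc k * R    ≡⟨ *-distribˡ-+ (suc k) Q R ⟨
  suc k * (Q + R)          ≡⟨ cong (suc k *_) (pascal (k + m) k) ⟨
  suc k * (suc (k + m) C suc k) ≡⟨ absorb (k + m) k ⟩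
  suc (k + m) * Q          ≡⟨ *-distribʳ-+ Q (suc k) m ⟩
  suc k * Q + m * Q        ∎)
  where
  open ≡-Reasoning
  Q = (k + m) C k
  R = (k + m) C suc k

C-shrink : ∀ k m → suc (k + m) * ((k + m) C k) ≡ suc m * (suc (k + m) C k)
C-shrink k m = begin
  suc (k + m) * ((k + m) C k)              ≡⟨ absorb (k + m) k ⟨
  suc k * (suc (k + m) C suc k)            ≡⟨ cong (λ u → suc k * (u C suc k)) (+-suc k m) ⟨
  suc k * ((k + suc m) C suc k)            ≡⟨ C-ratio k (suc m) ⟩
  suc m * ((k + suc m) C k)                ≡⟨ cong (λ u → suc m * (u C k)) (+-suc k m) ⟩
  suc m * (suc (k + m) C k)                ∎
  where open ≡-Reasoning

-- For t ≤ s and x ≤ M C s, D M s t x is the number of t-sets contained in one of the first x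
-- s-subsets of [M] in colexicographic order.
D : ℕ → ℕ → ℕ → ℕ → ℕ
D⁺ : ℕ → ℕ → ℕ → ℕ → ℕ
D zero s t x = x
D (suc M) zero t x = x
D (suc M) (suc s) t x with x ≤? M C suc s
... | yes _ = D M (suc s) t x
... | no _ = M C t + D⁺ M s t (x ∸ M C suc s)
D⁺ M s zero y = 0
D⁺ M s (suc t) y = D M s t y

D-low : ∀ {M s t x} → x ≤ M C suc s → D (suc M) (suc s) t x ≡ D M (suc s) t x
D-low {M} {s} {t} {x} x≤ with x ≤? M C suc s
... | yes _ = refl
... | no x≰ = ⊥-elim (x≰ x≤)

-- In colexicographic order the sets without the top point come first. Once there is a set beyond
-- them, every `t`-subset of `[M]` is covered, and `D⁺` counts the `t`-sets through the top point,
-- with that point removed.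
D-high : ∀ M s t {x} → M C suc s < x →
  D (suc M) (suc s) t x ≡ M C t + D⁺ M s t (x ∸ M C suc s)
D-high M s t {x} x> with x ≤? M C suc s
... | yes x≤ = ⊥-elim (<⇒≱ x> x≤)
... | no x≰ = refl

D-high+ : ∀ M s t {y} → 0 < y →
  D (suc M) (suc s) t (M C suc s + y) ≡ M C t + D⁺ M s t y
D-high+ M s t {y} 0<y = trans (D-high M s t (m<m+n _ 0<y))
  (cong (λ z → M C t + D⁺ M s t z) (m+n∸m≡n (M C suc s) y))

D-zero : ∀ M s t → D M s t 0 ≡ 0
D-zero zero s t = refl
D-zero (suc M) zero t = refl
D-zero (suc M) (suc s) t = trans (D-low {M} {s} {t} z≤n) (D-zero M (suc s) t)

data Split (c x : ℕ) : Set where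
  low  : x ≤ c → Split c x
  high : ∀ y → 0 < y → x ≡ c + y → Split c x

split : ∀ c x → Split c x
split c x with x ≤? c
... | yes p = low p
... | no p = high (x ∸ c) (m<n⇒0<n∸m (≰⇒> p)) (sym (m+[n∸m]≡n (<⇒≤ (≰⇒> p))))

peel : ∀ M s {y} → M C suc s + y ≤ suc M C suc s → y ≤ M C s
peel M s {y} p = +-cancelˡ-≤ (M C suc s) _ _
  (subst (M C suc s + y ≤_) (trans (pascal M s) (+-comm (M C s) _)) p)

C-mono : ∀ M t → M C t ≤ suc M C t
C-mono M zero = ≤-refl
C-mono M (suc t) = subst (M C suc t ≤_) (sym (pascal M t)) (m≤n+m _ _)

D-bound : ∀ M {s t x} → t ≤ s → x ≤ M C s → D M s t x ≤ M C t
D-bound zero {zero} {zero} _ x≤ = x≤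
D-bound zero {suc s} _ x≤ = ≤-trans x≤ z≤n
D-bound (suc M) {zero} {zero} _ x≤ = x≤
D-bound (suc M) {suc s} {t} {x} t≤s x≤ with split (M C suc s) x
... | low p = subst (_≤ _) (sym (D-low {M} {s} {t} p)) (≤-trans (D-bound M t≤s p) (C-mono M t))
D-bound (suc M) {suc s} {zero} t≤s x≤ | high y 0<y refl =
  ≤-reflexive (trans (D-high+ M s 0 0<y) (+-identityʳ 1))
D-bound (suc M) {suc s} {suc t} (s≤s t≤s) x≤ | high y 0<y refl = begin
  D (suc M) (suc s) (suc t) (M C suc s + y) ≡⟨ D-high+ M s (suc t) 0<y ⟩
  M C suc t + D M s t y    ≤⟨ +-monoʳ-≤ (M C suc t) (D-bound M t≤s (peel M s x≤)) ⟩
  M C suc t + M C t        ≡⟨ +-comm (M C suc t) _ ⟩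
  M C t + M C suc t        ≡⟨ pascal M t ⟨
  suc M C suc t            ∎
  where open ≤-Reasoning

D-mono : ∀ M {s t x y} → t ≤ s → x ≤ y → y ≤ M C s → D M s t x ≤ D M s t y
D-mono zero _ x≤y _ = x≤y
D-mono (suc M) {zero} _ x≤y _ = x≤y
D-mono (suc M) {suc s} {t} {x} {y} t≤s x≤y y≤ with split (M C suc s) x | split (M C suc s) y
... | low p | low q = subst₂ _≤_ (sym (D-low {M} {s} {t} p)) (sym (D-low {M} {s} {t} q)) (D-mono M t≤s x≤y q)
... | low p | high v 0<v refl = begin
  D (suc M) (suc s) t x ≡⟨ D-low {M} {s} {t} p ⟩
  D M (suc s) t x       ≤⟨ D-bound M t≤s p ⟩
  M C t                 ≤⟨ m≤m+n _ _ ⟩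
  M C t + D⁺ M s t v    ≡⟨ D-high+ M s t 0<v ⟨
  D (suc M) (suc s) t (M C suc s + v) ∎
  where open ≤-Reasoning
... | high u 0<u refl | low q = ⊥-elim (<⇒≱ (m<m+n _ 0<u) (≤-trans x≤y q))
D-mono (suc M) {suc s} {zero} t≤s x≤y y≤ | high u 0<u refl | high v 0<v refl =
  ≤-reflexive (trans (D-high+ M s 0 0<u) (sym (D-high+ M s 0 0<v)))
D-mono (suc M) {suc s} {suc t} (s≤s t≤s) x≤y y≤ | high u 0<u refl | high v 0<v refl =
  subst₂ _≤_ (sym (D-high+ M s (suc t) 0<u)) (sym (D-high+ M s (suc t) 0<v))
    (+-monoʳ-≤ (M C suc t) (D-mono M t≤s (+-cancelˡ-≤ (M C suc s) _ _ x≤y) (peel M s y≤)))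

D-pos : ∀ M {s t x} → t ≤ s → 0 < x → x ≤ M C s → 0 < D M s t x
D-pos zero _ 0<x _ = 0<x
D-pos (suc M) {zero} _ 0<x _ = 0<x
D-pos (suc M) {suc s} {t} {x} t≤s 0<x x≤ with split (M C suc s) x
... | low p = subst (0 <_) (sym (D-low {M} {s} {t} p)) (D-pos M t≤s 0<x p)
D-pos (suc M) {suc s} {zero} t≤s 0<x x≤ | high y 0<y refl =
  subst (0 <_) (sym (D-high+ M s 0 0<y)) (s≤s z≤n)
D-pos (suc M) {suc s} {suc t} (s≤s t≤s) 0<x x≤ | high y 0<y refl =
  subst (0 <_) (sym (D-high+ M s (suc t) 0<y))
    (≤-trans (D-pos M t≤s 0<y (peel M s x≤)) (m≤n+m _ (M C suc t)))

D-full : ∀ M {s t} → t ≤ s → s ≤ M → D M s t (M C s) ≡ M C t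
D-full zero {zero} {zero} _ _ = refl
D-full (suc M) {zero} {zero} _ _ = refl
D-full (suc M) {suc s} {t} t≤s (s≤s s≤M) =
  trans (cong (D (suc M) (suc s) t) (trans (pascal M s) (+-comm (M C s) _)))
    (trans (D-high+ M s t (C-pos s≤M)) (rest t t≤s))
  where
  rest : ∀ t → t ≤ suc s → M C t + D⁺ M s t (M C s) ≡ suc M C t
  rest zero _ = refl
  rest (suc t) (s≤s t≤s) = trans (cong (M C suc t +_) (D-full M t≤s s≤M))
    (trans (+-comm (M C suc t) _) (sym (pascal M t)))

D-id : ∀ M s {x} → x ≤ M C s → D M s s x ≡ x
D-id zero s _ = refl
D-id (suc M) zero _ = refl
D-id (suc M) (suc s) {x} x≤ with split (M C suc s) x
... | low p = trans (D-low {M} {s} {suc s} p) (D-id M (suc s) p)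
... | high y 0<y refl = trans (D-high+ M s (suc s) 0<y) (cong (M C suc s +_) (D-id M s (peel M s x≤)))

-- The shadow of an initial colexicographic segment is again an initial segment. This is what lets
-- Kruskal-Katona be iterated on sizes alone.
D-comp : ∀ M {s t x} → t ≤ s → x ≤ M C suc s → D M s t (D M (suc s) s x) ≡ D M (suc s) t x
D-comp zero _ _ = refl
D-comp (suc M) {zero} {zero} _ _ = refl
D-comp (suc M) {suc s} {t} {x} t≤s x≤ with split (M C suc (suc s)) x
... | low p = begin
  D (suc M) (suc s) t (D (suc M) (suc (suc s)) (suc s) x)
    ≡⟨ cong (D (suc M) (suc s) t) (D-low {M} {suc s} {suc s} p) ⟩
  D (suc M) (suc s) t (D M (suc (suc s)) (suc s) x)
    ≡⟨ D-low {M} {s} {t} (D-bound M (n≤1+n _) p) ⟩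
  D M (suc s) t (D M (suc (suc s)) (suc s) x)
    ≡⟨ D-comp M t≤s p ⟩
  D M (suc (suc s)) t x
    ≡⟨ D-low {M} {suc s} {t} p ⟨
  D (suc M) (suc (suc s)) t x ∎
  where open ≡-Reasoning
... | high y 0<y refl = begin
  D (suc M) (suc s) t (D (suc M) (suc (suc s)) (suc s) (M C suc (suc s) + y))
    ≡⟨ cong (D (suc M) (suc s) t) (D-high+ M (suc s) (suc s) 0<y) ⟩
  D (suc M) (suc s) t (M C suc s + D M (suc s) s y)
    ≡⟨ D-high+ M s t (D-pos M (n≤1+n s) 0<y y≤) ⟩
  M C t + D⁺ M s t (D M (suc s) s y)
    ≡⟨ cong (M C t +_) (rest t t≤s) ⟩
  M C t + D⁺ M (suc s) t y
    ≡⟨ D-high+ M (suc s) t 0<y ⟨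
  D (suc M) (suc (suc s)) t (M C suc (suc s) + y) ∎
  where
  open ≡-Reasoning
  y≤ = peel M (suc s) x≤
  rest : ∀ t → t ≤ suc s → D⁺ M s t (D M (suc s) s y) ≡ D⁺ M (suc s) t y
  rest zero _ = refl
  rest (suc t) (s≤s t≤s) = D-comp M t≤s y≤

-- Immediate shadows of initial colexicographic segments

sh : ℕ → ℕ → ℕ → ℕ
sh M zero x = 0
sh M (suc s) x = D M (suc s) s x

sh-high : ∀ M s {y} → 0 < y → sh (suc M) (suc s) (M C suc s + y) ≡ M C s + sh M s y
sh-high M zero 0<y = D-high+ M 0 0 0<y
sh-high M (suc s) 0<y = D-high+ M (suc s) (suc s) 0<y

sh-low : ∀ M s {x} → x ≤ M C s → sh (suc M) s x ≡ sh M s x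
sh-low M zero _ = refl
sh-low M (suc s) x≤ = D-low {M} {s} {s} x≤

sh-mono : ∀ M s {x y} → x ≤ y → y ≤ M C s → sh M s x ≤ sh M s y
sh-mono M zero _ _ = z≤n
sh-mono M (suc s) x≤y y≤ = D-mono M (n≤1+n s) x≤y y≤

sh-bound : ∀ M s {x} → x ≤ M C suc s → sh M (suc s) x ≤ M C s
sh-bound M s x≤ = D-bound M (n≤1+n s) x≤

sh-pos : ∀ M s {x} → 0 < x → x ≤ M C suc s → 0 < sh M (suc s) x
sh-pos M s 0<x x≤ = D-pos M (n≤1+n s) 0<x x≤

-- If the two sections of a family have sizes x₀ and x₁, and the section avoiding the pivot
-- has its shadow inside the other section, then the shadow is at least as large as for an
-- initial colexicographic segment of size x₀ + x₁.
sh-split : ∀ M s {x₀ x₁} → x₀ ≤ M C suc s → x₁ ≤ M C s → sh M (suc s) x₀ ≤ x₁ →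
  sh (suc M) (suc s) (x₀ + x₁) ≤ x₁ + sh M s x₁
sh-split M zero {zero} {zero} _ _ _ = ≤-reflexive (D-zero (suc M) 1 0)
sh-split M zero {x₀} {x₁@(suc _)} x₀≤ x₁≤ _ = ≤-trans
  (sh-bound (suc M) 0 (subst (x₀ + x₁ ≤_) (trans (+-comm (M C 1) 1) (sym (pascal M 0))) (+-mono-≤ x₀≤ x₁≤)))
  (s≤s z≤n)
sh-split M zero {x₀@(suc _)} {zero} x₀≤ _ h = ⊥-elim (<⇒≱ (sh-pos M 0 (s≤s z≤n) x₀≤) h)
sh-split zero (suc s) {x₀} {x₁} x₀≤ x₁≤ _
  rewrite n≤0⇒n≡0 x₀≤ | n≤0⇒n≡0 x₁≤ | D-zero 1 (suc (suc s)) (suc s) = z≤n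
sh-split (suc M) (suc s) {x₀} {x₁} x₀≤ x₁≤ h
  with split (M C suc s) x₁ | split (M C suc (suc s)) x₀
... | low p₁ | high y₀ 0<y₀ refl = ⊥-elim (<⇒≱
        (m<m+n (M C suc s) (sh-pos M s 0<y₀ (peel M (suc s) x₀≤)))
        (≤-trans (subst (_≤ x₁) (sh-high M (suc s) 0<y₀) h) p₁))
... | low p₁ | low p₀ = subst₂ _≤_ (sym (sh-low (suc M) (suc (suc s)) x≤))
        (cong (x₁ +_) (sym (sh-low M (suc s) p₁)))
        (sh-split M (suc s) p₀ p₁ (subst (_≤ x₁) (sh-low M (suc (suc s)) p₀) h))
  where
  x≤ : x₀ + x₁ ≤ suc M C suc (suc s)
  x≤ = subst (x₀ + x₁ ≤_) (trans (+-comm (M C suc (suc s)) _) (sym (pascal M (suc s)))) (+-mono-≤ p₀ p₁)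
... | high y₁ 0<y₁ refl | s₀ with split (suc M C suc (suc s)) (x₀ + (M C suc s + y₁))
...   | low p = begin
          sh (suc (suc M)) (suc (suc s)) (x₀ + (M C suc s + y₁))   ≡⟨ sh-low (suc M) (suc (suc s)) {x₀ + (M C suc s + y₁)} p ⟩
          sh (suc M) (suc (suc s)) (x₀ + (M C suc s + y₁))         ≤⟨ sh-bound (suc M) (suc s) {x₀ + (M C suc s + y₁)} p ⟩
          suc M C suc s                      ≡⟨ pascal M s ⟩
          M C s + M C suc s                  ≡⟨ +-comm (M C s) _ ⟩
          M C suc s + M C s                  ≤⟨ +-mono-≤ (m≤m+n (M C suc s) y₁) (m≤m+n (M C s) (sh M s y₁)) ⟩
          (M C suc s + y₁) + (M C s + sh M s y₁)
            ≡⟨ cong (M C suc s + y₁ +_) (sym (sh-high M s 0<y₁)) ⟩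
          (M C suc s + y₁) + sh (suc M) (suc s) (M C suc s + y₁) ∎
  where open ≤-Reasoning
...   | high z 0<z eq = begin
          sh (suc (suc M)) (suc (suc s)) (x₀ + (M C suc s + y₁))
            ≡⟨ cong (sh (suc (suc M)) (suc (suc s))) eq ⟩
          sh (suc (suc M)) (suc (suc s)) (suc M C suc (suc s) + z)
            ≡⟨ sh-high (suc M) (suc s) 0<z ⟩
          suc M C suc s + sh (suc M) (suc s) z
            ≤⟨ +-monoʳ-≤ (suc M C suc s) (core s₀) ⟩
          suc M C suc s + (y₁ + sh M s y₁)
            ≡⟨ cong (_+ (y₁ + sh M s y₁)) (pascal M s) ⟩
          (M C s + M C suc s) + (y₁ + sh M s y₁)
            ≡⟨ shuffle (M C s) (M C suc s) y₁ (sh M s y₁) ⟩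
          (M C suc s + y₁) + (M C s + sh M s y₁)
            ≡⟨ cong (M C suc s + y₁ +_) (sym (sh-high M s 0<y₁)) ⟩
          (M C suc s + y₁) + sh (suc M) (suc s) (M C suc s + y₁) ∎
  where
  open ≤-Reasoning
  shuffle : ∀ a b c d → (a + b) + (c + d) ≡ (b + c) + (a + d)
  shuffle = solve-∀
  y₁≤ : y₁ ≤ M C s
  y₁≤ = peel M s x₁≤
  move : ∀ x a b y → x + (a + y) ≡ a + (x + y)
  move x a b y = trans (sym (+-assoc x a y)) (trans (cong (_+ y) (+-comm x a)) (+-assoc a x y))
  eq′ : M C suc (suc s) + z ≡ x₀ + y₁
  eq′ = +-cancelˡ-≡ (M C suc s) _ _ (trans (sym (+-assoc (M C suc s) _ z))
    (trans (cong (_+ z) (sym (pascal M (suc s))))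
    (trans (sym eq) (move x₀ (M C suc s) 0 y₁))))
  core : Split (M C suc (suc s)) x₀ → sh (suc M) (suc s) z ≤ y₁ + sh M s y₁
  -- Here `z ≤ y₁`, so it is enough to bound the shadow for `y₁`, which is the induction hypothesis
  -- with an empty pivot-free section.
  core (low p₀) = ≤-trans
    (sh-mono (suc M) (suc s) z≤y₁ (≤-trans y₁≤ (subst (M C s ≤_) (sym (pascal M s)) (m≤m+n _ _))))
    (sh-split M s {0} z≤n y₁≤ (subst (_≤ y₁) (sym (D-zero M (suc s) s)) z≤n))
    where
    z≤y₁ : z ≤ y₁
    z≤y₁ = +-cancelˡ-≤ (M C suc (suc s)) _ _ (subst (_≤ M C suc (suc s) + y₁) (sym eq′) (+-monoˡ-≤ y₁ p₀))
  core (high y₀ 0<y₀ refl) = subst (λ u → sh (suc M) (suc s) u ≤ y₁ + sh M s y₁) (sym z≡)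
    (sh-split M s (peel M (suc s) x₀≤) y₁≤
      (+-cancelˡ-≤ (M C suc s) _ _ (subst (_≤ M C suc s + y₁) (sh-high M (suc s) 0<y₀) h)))
    where
    z≡ : z ≡ y₀ + y₁
    z≡ = +-cancelˡ-≡ (M C suc (suc s)) _ _ (trans eq′ (+-assoc _ y₀ y₁))

-- Families and their sections

infix 8 _⁰ _¹
infix 4 _⊑_
infixr 6 _⊓ᶠ_
infixr 5 _⊔ᶠ_

_⁰ _¹ : ∀ {n} → Family (suc n) → Family n
(F ⁰) A = F (outside ∷ A)
(F ¹) A = F (inside ∷ A)

_⊑_ : ∀ {n} → Family n → Family n → Set
F ⊑ G = ∀ A → T (F A) → T (G A)

_⊓ᶠ_ _⊔ᶠ_ : ∀ {n} → Family n → Family n → Family n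
(F ⊓ᶠ G) A = F A ∧ G A
(F ⊔ᶠ G) A = F A ∨ G A

∧⁻ : ∀ {x y} → T (x ∧ y) → T x × T y
∧⁻ = Equivalence.to T-∧

∧⁺ : ∀ {x y} → T x → T y → T (x ∧ y)
∧⁺ p q = Equivalence.from T-∧ (p , q)

∨⁻ : ∀ {x y} → T (x ∨ y) → T x ⊎ T y
∨⁻ = Equivalence.to T-∨

∨⁺ˡ : ∀ {x y} → T x → T (x ∨ y)
∨⁺ˡ p = Equivalence.from T-∨ (inj₁ p)

∨⁺ʳ : ∀ {x y} → T y → T (x ∨ y)
∨⁺ʳ {x} q = Equivalence.from (T-∨ {x}) (inj₂ q)

indicator : Bool → ℕ
indicator b = if b then 1 else 0

card-suc : ∀ {n} (F : Family (suc n)) → card F ≡ card (F ⁰) + card (F ¹)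
card-suc {n} F = begin
  sum (map (indicator ∘ F) (allSubsets (suc n)))
    ≡⟨ cong sum (map-++ (indicator ∘ F) (map (outside ∷_) (allSubsets n)) _) ⟩
  sum (map (indicator ∘ F) (map (outside ∷_) (allSubsets n)) ++ map (indicator ∘ F) (map (inside ∷_) (allSubsets n)))
    ≡⟨ sum-++ (map (indicator ∘ F) (map (outside ∷_) (allSubsets n))) _ ⟩
  _ ≡⟨ sym (cong₂ _+_ (cong sum (map-∘ (allSubsets n))) (cong sum (map-∘ (allSubsets n)))) ⟩
  card (F ⁰) + card (F ¹) ∎
  where open ≡-Reasoning

card-zero : (F : Family 0) → card F ≡ indicator (F [])
card-zero F = +-identityʳ _

indicator-mono : ∀ {x y} → (T x → T y) → indicator x ≤ indicator y
indicator-mono {false} _ = z≤n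
indicator-mono {true} {true} _ = ≤-refl
indicator-mono {true} {false} h = ⊥-elim (h tt)

card-mono : ∀ {n} {F G : Family n} → F ⊑ G → card F ≤ card G
card-mono {zero} {F} {G} h = subst₂ _≤_ (sym (card-zero F)) (sym (card-zero G)) (indicator-mono (h []))
card-mono {suc n} {F} {G} h = subst₂ _≤_ (sym (card-suc F)) (sym (card-suc G))
  (+-mono-≤ (card-mono (h ∘ (outside ∷_))) (card-mono (h ∘ (inside ∷_))))

card-empty : ∀ {n} {F : Family n} → (∀ A → ¬ T (F A)) → card F ≡ 0
card-empty {zero} {F} h with F [] | h []
... | false | _ = refl
... | true | ¬t = ⊥-elim (¬t tt)
card-empty {suc n} {F} h =
  trans (card-suc F) (cong₂ _+_ (card-empty (h ∘ (outside ∷_))) (card-empty (h ∘ (inside ∷_))))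

+-interchange : ∀ a b c d → (a + b) + (c + d) ≡ (a + c) + (b + d)
+-interchange = solve-∀

card-⊓⊔ : ∀ {n} (F G : Family n) → card (F ⊓ᶠ G) + card (F ⊔ᶠ G) ≡ card F + card G
card-⊓⊔ {zero} F G with F [] | G []
... | false | false = refl
... | false | true = refl
... | true | false = refl
... | true | true = refl
card-⊓⊔ {suc n} F G = begin
  card (F ⊓ᶠ G) + card (F ⊔ᶠ G)
    ≡⟨ cong₂ _+_ (card-suc (F ⊓ᶠ G)) (card-suc (F ⊔ᶠ G)) ⟩
  (card (F ⁰ ⊓ᶠ G ⁰) + card (F ¹ ⊓ᶠ G ¹)) + (card (F ⁰ ⊔ᶠ G ⁰) + card (F ¹ ⊔ᶠ G ¹))
    ≡⟨ +-interchange (card (F ⁰ ⊓ᶠ G ⁰)) _ _ _ ⟩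
  (card (F ⁰ ⊓ᶠ G ⁰) + card (F ⁰ ⊔ᶠ G ⁰)) + (card (F ¹ ⊓ᶠ G ¹) + card (F ¹ ⊔ᶠ G ¹))
    ≡⟨ cong₂ _+_ (card-⊓⊔ (F ⁰) (G ⁰)) (card-⊓⊔ (F ¹) (G ¹)) ⟩
  (card (F ⁰) + card (G ⁰)) + (card (F ¹) + card (G ¹))
    ≡⟨ +-interchange (card (F ⁰)) _ _ _ ⟩
  (card (F ⁰) + card (F ¹)) + (card (G ⁰) + card (G ¹))
    ≡⟨ cong₂ _+_ (card-suc F) (card-suc G) ⟨
  card F + card G ∎
  where open ≡-Reasoning

⊑-or-< : ∀ {n} (F G : Family n) → F ⊑ G ⊎ card (F ⊓ᶠ G) < card F
⊑-or-< {zero} F G with F [] in f | G [] in g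
... | false | _ = inj₁ (λ { [] t → ⊥-elim (subst T f t) })
... | true | true = inj₁ (λ { [] _ → subst T (sym g) tt })
... | true | false = inj₂ (s≤s z≤n)
⊑-or-< {suc n} F G with ⊑-or-< (F ⁰) (G ⁰) | ⊑-or-< (F ¹) (G ¹)
... | inj₁ p | inj₁ q = inj₁ (λ { (outside ∷ A) → p A ; (inside ∷ A) → q A })
... | inj₂ p | _ = inj₂ (subst₂ _<_ (sym (card-suc (F ⊓ᶠ G))) (sym (card-suc F))
        (+-mono-<-≤ p (card-mono {F = F ¹ ⊓ᶠ G ¹} {F ¹} (λ _ t → proj₁ (∧⁻ t)))))
... | inj₁ _ | inj₂ q = inj₂ (subst₂ _<_ (sym (card-suc (F ⊓ᶠ G))) (sym (card-suc F))
        (+-mono-≤-< (card-mono {F = F ⁰ ⊓ᶠ G ⁰} {F ⁰} (λ _ t → proj₁ (∧⁻ t))) q))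

⊑-antisym-card : ∀ {n} {F G : Family n} → F ⊑ G → card G ≤ card F → G ⊑ F
⊑-antisym-card {F = F} {G} F⊑G c with ⊑-or-< G F
... | inj₁ p = p
... | inj₂ q = ⊥-elim (<⇒≱ q (≤-trans c (card-mono (λ A t → ∧⁺ (F⊑G A t) t))))

uniform⁰ : ∀ {n s} {F : Family (suc n)} → Uniform s F → Uniform s (F ⁰)
uniform⁰ u A = u (outside ∷ A)

uniform¹ : ∀ {n s} {F : Family (suc n)} → Uniform (suc s) F → Uniform s (F ¹)
uniform¹ u A t = suc-injective (u (inside ∷ A) t)

uniform-⊑ : ∀ {n s} {F G : Family n} → F ⊑ G → Uniform s G → Uniform s F
uniform-⊑ h u A t = u A (h A t)

card≤C : ∀ {n} s {F : Family n} → Uniform s F → card F ≤ n C s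
card≤C {zero} zero {F} u = subst (_≤ 1) (sym (card-zero F)) (indicator-mono {y = true} _)
card≤C {zero} (suc s) {F} u =
  ≤-reflexive (card-empty {F = F} (λ { [] t → 0≢1+n (u [] t) }))
card≤C {suc n} zero {F} u = subst (_≤ 1) (sym (trans (card-suc F)
  (trans (cong (card (F ⁰) +_) (card-empty (λ A t → 0≢1+n (sym (u (inside ∷ A) t))))) (+-identityʳ _))))
  (card≤C zero (uniform⁰ {F = F} u))
card≤C {suc n} (suc s) {F} u = subst₂ _≤_ (sym (card-suc F))
  (trans (+-comm (n C suc s) _) (sym (pascal n s)))
  (+-mono-≤ (card≤C (suc s) (uniform⁰ {F = F} u)) (card≤C s (uniform¹ {F = F} u)))

-- G contains every set obtained by deleting one element from a member of F.
Shadow : ∀ {n} → Family n → Family n → Set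
Shadow {zero} F G = ⊤
Shadow {suc n} F G = F ¹ ⊑ G ⁰ × Shadow (F ⁰) (G ⁰) × Shadow (F ¹) (G ¹)

Shadow-⊓ : ∀ {n} {F F′ G G′ : Family n} → Shadow F G → Shadow F′ G′ → Shadow (F ⊓ᶠ F′) (G ⊓ᶠ G′)
Shadow-⊓ {zero} _ _ = tt
Shadow-⊓ {suc n} (a , b , c) (a′ , b′ , c′) =
  (λ A t → ∧⁺ (a A (proj₁ (∧⁻ t))) (a′ A (proj₂ (∧⁻ t)))) , Shadow-⊓ b b′ , Shadow-⊓ c c′

⊔-mono : ∀ {n} {F F′ G G′ : Family n} → F ⊑ G → F′ ⊑ G′ → F ⊔ᶠ F′ ⊑ G ⊔ᶠ G′
⊔-mono p q A t with ∨⁻ t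
... | inj₁ f = ∨⁺ˡ (p A f)
... | inj₂ f = ∨⁺ʳ (q A f)

Shadow-⊔ : ∀ {n} {F F′ G G′ : Family n} → Shadow F G → Shadow F′ G′ → Shadow (F ⊔ᶠ F′) (G ⊔ᶠ G′)
Shadow-⊔ {zero} _ _ = tt
Shadow-⊔ {suc n} {F} {F′} {G} {G′} (a , b , c) (a′ , b′ , c′) =
  ⊔-mono {F = F ¹} {F′ ¹} {G ⁰} {G′ ⁰} a a′ , Shadow-⊔ b b′ , Shadow-⊔ c c′

-- The compression that replaces the element i by a new pivot element, where possible, acting on
-- a family with pivot-free section F₀ and pivot section F₁.
shift₀ shift₁ : ∀ {n} → Fin n → Family n → Family n → Family n
shift₀ zero F₀ F₁ (outside ∷ A) = F₀ (outside ∷ A)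
shift₀ zero F₀ F₁ (inside ∷ A) = F₀ (inside ∷ A) ∧ F₁ (outside ∷ A)
shift₀ (suc i) F₀ F₁ (outside ∷ A) = shift₀ i (F₀ ⁰) (F₁ ⁰) A
shift₀ (suc i) F₀ F₁ (inside ∷ A) = shift₀ i (F₀ ¹) (F₁ ¹) A
shift₁ zero F₀ F₁ (outside ∷ A) = F₀ (inside ∷ A) ∨ F₁ (outside ∷ A)
shift₁ zero F₀ F₁ (inside ∷ A) = F₁ (inside ∷ A)
shift₁ (suc i) F₀ F₁ (outside ∷ A) = shift₁ i (F₀ ⁰) (F₁ ⁰) A
shift₁ (suc i) F₀ F₁ (inside ∷ A) = shift₁ i (F₀ ¹) (F₁ ¹) A

shift-card : ∀ {n} (i : Fin n) (F₀ F₁ : Family n) →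
  card (shift₀ i F₀ F₁) + card (shift₁ i F₀ F₁) ≡ card F₀ + card F₁
shift-card {suc n} i F₀ F₁ = begin
  card S₀ + card S₁
    ≡⟨ cong₂ _+_ (card-suc S₀) (card-suc S₁) ⟩
  (card (S₀ ⁰) + card (S₀ ¹)) + (card (S₁ ⁰) + card (S₁ ¹))
    ≡⟨ sections i F₀ F₁ ⟩
  (card (F₀ ⁰) + card (F₀ ¹)) + (card (F₁ ⁰) + card (F₁ ¹))
    ≡⟨ cong₂ _+_ (card-suc F₀) (card-suc F₁) ⟨
  card F₀ + card F₁ ∎
  where
  open ≡-Reasoning
  S₀ = shift₀ i F₀ F₁
  S₁ = shift₁ i F₀ F₁
  middle : ∀ a b c d → (a + b) + (c + d) ≡ a + (b + c) + d
  middle = solve-∀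
  sections : ∀ (i : Fin (suc n)) F₀ F₁ →
    (card (shift₀ i F₀ F₁ ⁰) + card (shift₀ i F₀ F₁ ¹)) + (card (shift₁ i F₀ F₁ ⁰) + card (shift₁ i F₀ F₁ ¹)) ≡
    (card (F₀ ⁰) + card (F₀ ¹)) + (card (F₁ ⁰) + card (F₁ ¹))
  sections zero F₀ F₁ =
    trans (middle (card (F₀ ⁰)) (card (F₀ ¹ ⊓ᶠ F₁ ⁰)) (card (F₀ ¹ ⊔ᶠ F₁ ⁰)) (card (F₁ ¹)))
      (trans (cong (λ u → card (F₀ ⁰) + u + card (F₁ ¹)) (card-⊓⊔ (F₀ ¹) (F₁ ⁰)))
        (sym (middle (card (F₀ ⁰)) (card (F₀ ¹)) (card (F₁ ⁰)) (card (F₁ ¹)))))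
  sections (suc i) F₀ F₁ =
    trans (+-interchange (card (shift₀ i (F₀ ⁰) (F₁ ⁰))) _ _ _)
      (trans (cong₂ _+_ (shift-card i (F₀ ⁰) (F₁ ⁰)) (shift-card i (F₀ ¹) (F₁ ¹)))
        (+-interchange (card (F₀ ⁰)) _ _ _))

shift₀-⊑ : ∀ {n} (i : Fin n) {F₀ F₁ : Family n} → shift₀ i F₀ F₁ ⊑ F₀
shift₀-⊑ zero (outside ∷ A) t = t
shift₀-⊑ zero (inside ∷ A) t = proj₁ (∧⁻ t)
shift₀-⊑ (suc i) (outside ∷ A) t = shift₀-⊑ i A t
shift₀-⊑ (suc i) (inside ∷ A) t = shift₀-⊑ i A t

shift₁-origin : ∀ {n} (i : Fin n) {F₀ F₁ : Family n} A → T (shift₁ i F₀ F₁ A) →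
  T (F₁ A) ⊎ (∃[ B ] (T (F₀ B) × ∣ B ∣ ≡ suc ∣ A ∣))
shift₁-origin zero (outside ∷ A) t with ∨⁻ t
... | inj₁ f = inj₂ (inside ∷ A , f , refl)
... | inj₂ f = inj₁ f
shift₁-origin zero (inside ∷ A) t = inj₁ t
shift₁-origin (suc i) (outside ∷ A) t with shift₁-origin i A t
... | inj₁ f = inj₁ f
... | inj₂ (B , f , e) = inj₂ (outside ∷ B , f , e)
shift₁-origin (suc i) (inside ∷ A) t with shift₁-origin i A t
... | inj₁ f = inj₁ f
... | inj₂ (B , f , e) = inj₂ (inside ∷ B , f , cong suc e)

shift₁-uniform : ∀ {n s} (i : Fin n) {F₀ F₁ : Family n} →
  Uniform (suc s) F₀ → Uniform s F₁ → Uniform s (shift₁ i F₀ F₁)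
shift₁-uniform i u₀ u₁ A t with shift₁-origin i A t
... | inj₁ f = u₁ A f
... | inj₂ (B , f , e) = suc-injective (trans (sym e) (u₀ B f))

shift₀-mono : ∀ {n} (i : Fin n) {F₀ F₁ G₀ G₁ : Family n} → F₀ ⊑ G₀ → F₁ ⊑ G₁ →
  shift₀ i F₀ F₁ ⊑ shift₀ i G₀ G₁
shift₀-mono zero p q (outside ∷ A) t = p (outside ∷ A) t
shift₀-mono zero p q (inside ∷ A) t = ∧⁺ (p (inside ∷ A) (proj₁ (∧⁻ t))) (q (outside ∷ A) (proj₂ (∧⁻ t)))
shift₀-mono (suc i) p q (outside ∷ A) t = shift₀-mono i (p ∘ (outside ∷_)) (q ∘ (outside ∷_)) A t
shift₀-mono (suc i) p q (inside ∷ A) t = shift₀-mono i (p ∘ (inside ∷_)) (q ∘ (inside ∷_)) A t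

shift₁-mono : ∀ {n} (i : Fin n) {F₀ F₁ G₀ G₁ : Family n} → F₀ ⊑ G₀ → F₁ ⊑ G₁ →
  shift₁ i F₀ F₁ ⊑ shift₁ i G₀ G₁
shift₁-mono zero {F₀} {F₁} {G₀} {G₁} p q (outside ∷ A) t =
  ⊔-mono {F = F₀ ¹} {F₁ ⁰} {G₀ ¹} {G₁ ⁰} (p ∘ (inside ∷_)) (q ∘ (outside ∷_)) A t
shift₁-mono zero p q (inside ∷ A) t = q (inside ∷ A) t
shift₁-mono (suc i) p q (outside ∷ A) t = shift₁-mono i (p ∘ (outside ∷_)) (q ∘ (outside ∷_)) A t
shift₁-mono (suc i) p q (inside ∷ A) t = shift₁-mono i (p ∘ (inside ∷_)) (q ∘ (inside ∷_)) A t

-- A set that moves into the pivot section comes from some `B` through `i`. Deleting the pivot from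
-- it leaves `B` without `i`, a member of the shadow of `B`. With the next two lemmas this gives the
-- condition on shadows for the shifted families.
shift-cross : ∀ {n} (i : Fin n) {F₀ F₁ G₀ G₁ : Family n} →
  F₁ ⊑ G₀ → Shadow F₀ G₀ → Shadow F₁ G₁ → shift₁ i F₀ F₁ ⊑ shift₀ i G₀ G₁
shift-cross zero a (b , _) (c , _) (outside ∷ A) t with ∨⁻ t
... | inj₁ f = b A f
... | inj₂ f = a (outside ∷ A) f
shift-cross zero a (b , _) (c , _) (inside ∷ A) t = ∧⁺ (a (inside ∷ A) t) (c A t)
shift-cross (suc i) a (_ , b , _) (_ , c , _) (outside ∷ A) t = shift-cross i (a ∘ (outside ∷_)) b c A t
shift-cross (suc i) a (_ , _ , b) (_ , _ , c) (inside ∷ A) t = shift-cross i (a ∘ (inside ∷_)) b c A t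

shift₀-Shadow : ∀ {n} (i : Fin n) {F₀ F₁ G₀ G₁ : Family n} →
  Shadow F₀ G₀ → Shadow F₁ G₁ → Shadow (shift₀ i F₀ F₁) (shift₀ i G₀ G₁)
shift₀-Shadow zero (a , b , c) (a′ , b′ , c′) = (λ A t → a A (proj₁ (∧⁻ t))) , b , Shadow-⊓ c b′
shift₀-Shadow (suc i) (a , b , c) (a′ , b′ , c′) =
  shift₀-mono i a a′ , shift₀-Shadow i b b′ , shift₀-Shadow i c c′

shift₁-Shadow : ∀ {n} (i : Fin n) {F₀ F₁ G₀ G₁ : Family n} →
  Shadow F₀ G₀ → Shadow F₁ G₁ → Shadow (shift₁ i F₀ F₁) (shift₁ i G₀ G₁)
shift₁-Shadow zero (a , b , c) (a′ , b′ , c′) = (λ A t → ∨⁺ʳ (a′ A t)) , Shadow-⊔ c b′ , c′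
shift₁-Shadow (suc i) (a , b , c) (a′ , b′ , c′) =
  shift₁-mono i a a′ , shift₁-Shadow i b b′ , shift₁-Shadow i c c′

-- `shift₀ i` keeps a set `A` through `i` exactly when `A` without `i` lies in `F₁`. So a pair that
-- no shift changes has the shadow of `F₀` inside `F₁`, and any effective shift lowers `card F₀`,
-- which serves as the termination measure.
compressed-or-shift : ∀ {n} (F₀ F₁ : Family n) →
  Shadow F₀ F₁ ⊎ (∃[ i ] card (shift₀ i F₀ F₁) < card F₀)
compressed-or-shift {zero} F₀ F₁ = inj₁ tt
compressed-or-shift {suc n} F₀ F₁ with ⊑-or-< (F₀ ¹) (F₁ ⁰)
... | inj₂ c = inj₂ (zero , subst₂ _<_ (sym (card-suc (shift₀ zero F₀ F₁))) (sym (card-suc F₀))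
        (+-monoʳ-< (card (F₀ ⁰)) c))
... | inj₁ a with compressed-or-shift (F₀ ⁰) (F₁ ⁰) | compressed-or-shift (F₀ ¹) (F₁ ¹)
...   | inj₁ b | inj₁ c = inj₁ (a , b , c)
...   | inj₂ (i , c) | _ = inj₂ (suc i , subst₂ _<_ (sym (card-suc (shift₀ (suc i) F₀ F₁))) (sym (card-suc F₀))
          (+-mono-<-≤ c (card-mono (shift₀-⊑ i))))
...   | inj₁ _ | inj₂ (i , c) = inj₂ (suc i , subst₂ _<_ (sym (card-suc (shift₀ (suc i) F₀ F₁))) (sym (card-suc F₀))
          (+-mono-≤-< (card-mono (shift₀-⊑ i {F₀ ⁰} {F₁ ⁰})) c))

-- The Kruskal–Katona theorem

kruskal-katona : ∀ {n} s {F G : Family n} → Uniform s F → Shadow F G → sh n s (card F) ≤ card G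

-- Shifting towards the pivot preserves sizes and hypotheses and is repeated until the pair is
-- compressed. Then `G₀` contains `F₁` and `G₁` contains the shadow of `F₁`, so the bound depends on
-- `F₁` alone, and `sh-split` turns it into the bound for the whole family.
kruskal-katona-sections : ∀ {n} s fuel {F₀ F₁ G₀ G₁ : Family n} → card F₀ ≤ fuel →
  Uniform (suc s) F₀ → Uniform s F₁ → F₁ ⊑ G₀ → Shadow F₀ G₀ → Shadow F₁ G₁ →
  sh (suc n) (suc s) (card F₀ + card F₁) ≤ card G₀ + card G₁

kruskal-katona zero _ _ = z≤n
kruskal-katona {zero} (suc s) {F} {G} u _ =
  subst (_≤ card G) (sym (n≤0⇒n≡0 (card≤C (suc s) {F} u))) z≤n
kruskal-katona {suc n} (suc s) {F} {G} u (a , b , c) =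
  subst₂ _≤_ (cong (sh (suc n) (suc s)) (sym (card-suc F))) (sym (card-suc G))
    (kruskal-katona-sections s (card (F ⁰)) ≤-refl (uniform⁰ {F = F} u) (uniform¹ {F = F} u) a b c)

kruskal-katona-sections s fuel {F₀} {F₁} {G₀} {G₁} c≤ u₀ u₁ a b c with compressed-or-shift F₀ F₁
... | inj₁ compressed = ≤-trans
        (sh-split _ s (card≤C (suc s) u₀) (card≤C s u₁) (kruskal-katona (suc s) u₀ compressed))
        (+-mono-≤ (card-mono a) (kruskal-katona s u₁ c))
kruskal-katona-sections s zero {F₀} c≤ u₀ u₁ a b c | inj₂ (i , lt) = ⊥-elim (<⇒≱ lt (≤-trans c≤ z≤n))
kruskal-katona-sections {n} s (suc fuel) {F₀} {F₁} {G₀} {G₁} c≤ u₀ u₁ a b c | inj₂ (i , lt) =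
  subst₂ _≤_ (cong (sh (suc n) (suc s)) (shift-card i F₀ F₁)) (shift-card i G₀ G₁)
    (kruskal-katona-sections s fuel (s≤s⁻¹ (≤-trans lt c≤))
      (uniform-⊑ (shift₀-⊑ i) u₀) (shift₁-uniform i u₀ u₁)
      (shift-cross i a b c) (shift₀-Shadow i b c) (shift₁-Shadow i b c))

-- Sizes of cross-intersecting lexicographic segments

-- Lex n k l a b: an initial lexicographic segment of a k-subsets of [n] is cross-intersecting
-- with exactly b of the l-subsets.  The star of the first element is filled up first (fill-left),
-- and as long as it is not full, the l-subsets contain the whole star (fill-right).
data Lex : ℕ → ℕ → ℕ → ℕ → ℕ → Set where
  trivial : ∀ {n k l a b} → a * b ≡ 0 → a ≤ n C k → b ≤ n C l → Lex n k l a b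
  fill-left : ∀ {n k l a b} → Lex n (suc k) l a b → Lex (suc n) (suc k) (suc l) (n C k + a) b
  fill-right : ∀ {n k l a b} → Lex n k (suc l) a b → Lex (suc n) (suc k) (suc l) a (n C l + b)

Lex-left-bound : ∀ {n k l a b} → Lex n k l a b → a ≤ n C k
Lex-left-bound (trivial _ p _) = p
Lex-left-bound (fill-left {n} {k} {a = a} x) =
  subst (n C k + a ≤_) (sym (pascal n k)) (+-monoʳ-≤ (n C k) (Lex-left-bound x))
Lex-left-bound (fill-right {n} {k} {a = a} x) =
  subst (a ≤_) (sym (pascal n k)) (≤-trans (Lex-left-bound x) (m≤m+n _ _))

Lex-right-bound : ∀ {n k l a b} → Lex n k l a b → b ≤ n C l
Lex-right-bound (trivial _ _ p) = p
Lex-right-bound (fill-left {n} {l = l} {b = b} x) =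
  subst (b ≤_) (sym (pascal n l)) (≤-trans (Lex-right-bound x) (m≤m+n _ _))
Lex-right-bound (fill-right {n} {l = l} {b = b} x) =
  subst (n C l + b ≤_) (sym (pascal n l)) (+-monoʳ-≤ (n C l) (Lex-right-bound x))

-- `l + r` is the size of the complements of the `k`-sets. Complementation turns lexicographic
-- segments into colexicographic ones, with the first element as top point, so the two branches of
-- `D` match `fill-right` and `fill-left`.
lex : ∀ n k l r → n ≡ k + (l + r) → ∀ a → a ≤ n C k →
  ∃[ b ] (Lex n k l a b × n C l ≤ b + D n (l + r) l a)
lex n zero l r refl zero a≤ = n C l , trivial refl a≤ ≤-refl , m≤m+n _ _
lex n zero l r refl (suc zero) a≤ = 0 , trivial refl a≤ z≤n ,
  ≤-reflexive (sym (trans (cong (D n n l) (sym (nCn≡1 n))) (D-full n (m≤m+n l r) ≤-refl)))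
lex n zero l r refl (suc (suc a)) (s≤s ())
lex n (suc k) zero r e zero a≤ = 1 , trivial refl a≤ ≤-refl , m≤m+n _ _
lex n (suc k) zero r e a@(suc _) a≤ = 0 , trivial (*-zeroʳ a) a≤ z≤n ,
  D-pos n z≤n (s≤s z≤n) (subst (a ≤_) (trans (cong (_C suc k) e)
    (trans (sym (C-sym (suc k) r)) (cong (_C r) (sym e)))) a≤)
lex (suc n) (suc k) (suc l) r e a a≤ with split (n C (suc l + r)) a
... | low p with lex n k (suc l) r (suc-injective e) a
                 (subst (a ≤_) (trans (cong (_C (suc l + r)) (suc-injective e))
                   (trans (C-sym k (suc l + r)) (cong (_C k) (sym (suc-injective e))))) p)
...   | b , x , h = n C l + b , fill-right x , (begin
          suc n C suc l                           ≡⟨ pascal n l ⟩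
          n C l + n C suc l                       ≤⟨ +-monoʳ-≤ (n C l) h ⟩
          n C l + (b + D n (suc l + r) (suc l) a) ≡⟨ +-assoc (n C l) b _ ⟨
          n C l + b + D n (suc l + r) (suc l) a
            ≡⟨ cong (n C l + b +_) (sym (D-low {n} {l + r} {suc l} p)) ⟩
          n C l + b + D (suc n) (suc l + r) (suc l) a ∎)
  where open ≤-Reasoning
lex (suc n) (suc k) (suc l) r e a a≤ | high y 0<y a≡ with lex n (suc k) l r (trans (suc-injective e) (+-suc k (l + r))) y
    (+-cancelˡ-≤ (n C k) _ _ (subst₂ _≤_ (trans a≡ (cong (_+ y) top)) (pascal n k) a≤))
  where
  top : n C (suc l + r) ≡ n C k
  top = trans (cong (_C (suc l + r)) (suc-injective e))
          (trans (C-sym k (suc l + r)) (cong (_C k) (sym (suc-injective e))))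
... | b , x , h = b , subst (λ u → Lex (suc n) (suc k) (suc l) u b) (sym a≡′) (fill-left x) , (begin
          suc n C suc l                           ≡⟨ pascal n l ⟩
          n C l + n C suc l                       ≤⟨ +-monoˡ-≤ (n C suc l) h ⟩
          b + D n (l + r) l y + n C suc l         ≡⟨ +-assoc b _ _ ⟩
          b + (D n (l + r) l y + n C suc l)       ≡⟨ cong (b +_) (+-comm (D n (l + r) l y) _) ⟩
          b + (n C suc l + D n (l + r) l y)
            ≡⟨ cong (b +_) (sym (trans (cong (D (suc n) (suc l + r) (suc l)) a≡) (D-high+ n (l + r) (suc l) 0<y))) ⟩
          b + D (suc n) (suc l + r) (suc l) a     ∎)
  where
  open ≤-Reasoning
  a≡′ : a ≡ n C k + y
  a≡′ = trans a≡ (cong (_+ y) (trans (cong (_C (suc l + r)) (suc-injective e))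
          (trans (C-sym k (suc l + r)) (cong (_C k) (sym (suc-injective e))))))

-- With α = a / K, β = b / L this says  n r α β ≤ k l (1 - α - β),  where r = n - k - l.
Strong : (n k l r K L a b : ℕ) → Set
Strong n k l r K L a b = n * (r * (a * b)) + k * l * (a * L + b * K) ≤ k * l * (K * L)

-- In densities: `r α β ≤ k (1 - α - β)` and `r α β ≤ l (1 - α - β)`. The first is the form that
-- `fill-left` needs from the smaller ground set, the second the form for `fill-right`.
record Weak (k l r K L a b : ℕ) : Set where
  constructor weak
  field
    left≤  : r * (a * b) + k * (a * L + b * K) ≤ k * (K * L)
    right≤ : r * (a * b) + l * (a * L + b * K) ≤ l * (K * L)

Strong-sym : ∀ {n k l r K L a b} → Strong n k l r K L a b → Strong n l k r L K b a
Strong-sym {n} {k} {l} {r} {K} {L} {a} {b} = subst₂ _≤_ (lhs n r a b k l L K) (rhs k l K L)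
  where
  lhs : ∀ n r a b k l L K → n * (r * (a * b)) + k * l * (a * L + b * K) ≡ n * (r * (b * a)) + l * k * (b * K + a * L)
  lhs = solve-∀
  rhs : ∀ k l K L → k * l * (K * L) ≡ l * k * (L * K)
  rhs = solve-∀

-- Apart from the use of `h` the chain consists of equalities: adding `k p L₁` and multiplying by
-- `n` turns the weak inequality without the first point into the strong one with it. Along the
-- induction, precision is lost only in `strong⇒weak`, where `n` is lowered to `l` or `k`.
strong-step : ∀ {n k l r p K₀ L₁ K L a b} → n ≡ k + (l + r) →
  k * K ≡ n * p → l * L ≡ n * L₁ → k * K₀ ≡ (l + r) * p →
  r * (a * b) + k * (a * L₁ + b * K₀) ≤ k * (K₀ * L₁) →
  Strong n k l r K L (p + a) b
strong-step {n} {k} {l} {r} {p} {K₀} {L₁} {K} {L} {a} {b} e eK eL eK₀ h = begin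
  n * (r * ((p + a) * b)) + k * l * ((p + a) * L + b * K)
    ≡⟨ ring₁ n r p a b k l L K ⟩
  n * (r * ((p + a) * b)) + ((p + a) * (k * (l * L)) + (l * b) * (k * K))
    ≡⟨ cong₂ (λ u v → n * (r * ((p + a) * b)) + ((p + a) * (k * u) + (l * b) * v)) eL eK ⟩
  n * (r * ((p + a) * b)) + ((p + a) * (k * (n * L₁)) + (l * b) * (n * p))
    ≡⟨ ring₂ n r p a b k l L₁ ⟩
  n * (r * (a * b) + k * (a * L₁) + b * ((l + r) * p) + k * p * L₁)
    ≡⟨ cong (λ u → n * (r * (a * b) + k * (a * L₁) + b * u + k * p * L₁)) (sym eK₀) ⟩
  n * (r * (a * b) + k * (a * L₁) + b * (k * K₀) + k * p * L₁)
    ≡⟨ ring₃ n r a b k L₁ K₀ p ⟩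
  n * ((r * (a * b) + k * (a * L₁ + b * K₀)) + k * p * L₁)
    ≤⟨ *-monoʳ-≤ n (+-monoˡ-≤ (k * p * L₁) h) ⟩
  n * (k * (K₀ * L₁) + k * p * L₁)
    ≡⟨ cong (λ u → n * (u + k * p * L₁)) (trans (sym (*-assoc k K₀ L₁)) (cong (_* L₁) eK₀)) ⟩
  n * ((l + r) * p * L₁ + k * p * L₁)
    ≡⟨ ring₄ n l r p L₁ k ⟩
  n * ((k + (l + r)) * p * L₁)
    ≡⟨ cong (λ u → n * (u * p * L₁)) (sym e) ⟩
  n * (n * p * L₁)
    ≡⟨ ring₅ n p L₁ ⟩
  n * p * (n * L₁)
    ≡⟨ cong₂ _*_ (sym eK) (sym eL) ⟩
  k * K * (l * L)
    ≡⟨ ring₆ k K l L ⟩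
  k * l * (K * L) ∎
  where
  open ≤-Reasoning
  ring₁ : ∀ n r p a b k l L K → n * (r * ((p + a) * b)) + k * l * ((p + a) * L + b * K) ≡
    n * (r * ((p + a) * b)) + ((p + a) * (k * (l * L)) + (l * b) * (k * K))
  ring₁ = solve-∀
  ring₂ : ∀ n r p a b k l L₁ → n * (r * ((p + a) * b)) + ((p + a) * (k * (n * L₁)) + (l * b) * (n * p)) ≡
    n * (r * (a * b) + k * (a * L₁) + b * ((l + r) * p) + k * p * L₁)
  ring₂ = solve-∀
  ring₃ : ∀ n r a b k L₁ K₀ p → n * (r * (a * b) + k * (a * L₁) + b * (k * K₀) + k * p * L₁) ≡
    n * ((r * (a * b) + k * (a * L₁ + b * K₀)) + k * p * L₁)
  ring₃ = solve-∀
  ring₄ : ∀ n l r p L₁ k → n * ((l + r) * p * L₁ + k * p * L₁) ≡ n * ((k + (l + r)) * p * L₁)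
  ring₄ = solve-∀
  ring₅ : ∀ n p L₁ → n * (n * p * L₁) ≡ n * p * (n * L₁)
  ring₅ = solve-∀
  ring₆ : ∀ k K l L → k * K * (l * L) ≡ k * l * (K * L)
  ring₆ = solve-∀

strong⇒weak : ∀ {n k l r K L a b} → suc k ≤ n → suc l ≤ n →
  Strong n (suc k) (suc l) r K L a b → Weak (suc k) (suc l) r K L a b
strong⇒weak {n} {k} {l} {r} {K} {L} {a} {b} k≤n l≤n h = weak
  (*-cancelˡ-≤ (suc l) (begin
    suc l * (r * (a * b) + suc k * X) ≡⟨ ringₗ (suc l) (r * (a * b)) (suc k) X ⟩
    suc l * (r * (a * b)) + suc k * suc l * X ≤⟨ +-monoˡ-≤ (suc k * suc l * X) (*-monoˡ-≤ (r * (a * b)) l≤n) ⟩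
    n * (r * (a * b)) + suc k * suc l * X ≤⟨ h ⟩
    suc k * suc l * (K * L) ≡⟨ swapₗ (suc k) (suc l) (K * L) ⟩
    suc l * (suc k * (K * L)) ∎))
  (*-cancelˡ-≤ (suc k) (begin
    suc k * (r * (a * b) + suc l * X) ≡⟨ ringᵣ (suc k) (r * (a * b)) (suc l) X ⟩
    suc k * (r * (a * b)) + suc k * suc l * X ≤⟨ +-monoˡ-≤ (suc k * suc l * X) (*-monoˡ-≤ (r * (a * b)) k≤n) ⟩
    n * (r * (a * b)) + suc k * suc l * X ≤⟨ h ⟩
    suc k * suc l * (K * L) ≡⟨ *-assoc (suc k) (suc l) (K * L) ⟩
    suc k * (suc l * (K * L)) ∎))
  where
  open ≤-Reasoning
  X = a * L + b * K
  ringₗ : ∀ l x k X → l * (x + k * X) ≡ l * x + k * l * X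
  ringₗ = solve-∀
  ringᵣ : ∀ k x l X → k * (x + l * X) ≡ k * x + k * l * X
  ringᵣ = solve-∀
  swapₗ : ∀ k l Y → k * l * Y ≡ l * (k * Y)
  swapₗ = solve-∀

sum≤-trivial : ∀ {K L} a b → a * b ≡ 0 → a ≤ K → b ≤ L → a * L + b * K ≤ K * L
sum≤-trivial {K} {L} a b ab a≤ b≤ with m*n≡0⇒m≡0∨n≡0 a ab
... | inj₁ refl = ≤-trans (*-monoˡ-≤ K b≤) (≤-reflexive (*-comm L K))
... | inj₂ refl = ≤-trans (≤-reflexive (+-identityʳ _)) (*-monoˡ-≤ L a≤)

-- Both constructors keep `r = n - k - l` fixed, so the induction stays within one `r`. Exchanging
-- the two families through `Strong-sym` reduces `fill-right` to the computation for `fill-left`.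
lex-strong : ∀ {n k l a b} r → n ≡ k + (l + r) → Lex n k l a b → Strong n k l r (n C k) (n C l) a b
lex-weak : ∀ {n k l a b} r → n ≡ k + (l + r) → Lex n k l a b → Weak k l r (n C k) (n C l) a b

lex-strong {n} {k} {l} {a} {b} r e (trivial ab a≤ b≤) =
  subst (λ u → n * (r * u) + k * l * (a * (n C l) + b * (n C k)) ≤ k * l * ((n C k) * (n C l))) (sym ab)
    (subst (λ u → u + k * l * (a * (n C l) + b * (n C k)) ≤ k * l * ((n C k) * (n C l)))
      (sym (trans (cong (n *_) (*-zeroʳ r)) (*-zeroʳ n)))
      (*-monoʳ-≤ (k * l) (sum≤-trivial a b ab a≤ b≤)))
lex-strong r e (fill-left {n} {k} {l} {a} {b} x) = strong-step {suc n} {suc k} {suc l} {r} {n C k} {n C suc k} {n C l} {a = a} {b} e (absorb n k) (absorb n l)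
  (trans (cong (λ m → suc k * (m C suc k)) (suc-injective e))
    (trans (C-ratio k (suc l + r)) (cong (λ m → (suc l + r) * (m C k)) {k + (suc l + r)} (sym (suc-injective e)))))
  (Weak.left≤ (lex-weak r (trans (suc-injective e) (+-suc k (l + r))) x))
lex-strong r e (fill-right {n} {k} {l} {a} {b} x) = Strong-sym {suc n} {suc l} {suc k} {r} {suc n C suc l} {suc n C suc k} {n C l + b} {a}
  (strong-step {suc n} {suc l} {suc k} {r} {n C l} {n C suc l} {n C k} {a = b} {a} e′ (absorb n l) (absorb n k)
    (trans (cong (λ m → suc l * (m C suc l)) (suc-injective e′))
      (trans (C-ratio l (suc k + r)) (cong (λ m → (suc k + r) * (m C l)) (sym (suc-injective e′)))))
    (subst₂ _≤_ (cong₂ (λ u v → r * u + suc l * v) (*-comm a b) (+-comm (a * (n C suc l)) _))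
      (cong (suc l *_) (*-comm (n C k) _))
      (Weak.right≤ (lex-weak r (suc-injective e) x))))
  where
  rotate : ∀ k l r → k + (l + r) ≡ l + (k + r)
  rotate = solve-∀
  e′ : suc n ≡ suc l + (suc k + r)
  e′ = trans e (rotate (suc k) (suc l) r)

lex-weak {n} {k} {l} {a} {b} r e (trivial ab a≤ b≤) = weak (both k) (both l)
  where
  s = sum≤-trivial a b ab a≤ b≤
  both : ∀ k′ → r * (a * b) + k′ * (a * (n C l) + b * (n C k)) ≤ k′ * ((n C k) * (n C l))
  both k′ = subst (λ u → u + k′ * (a * (n C l) + b * (n C k)) ≤ k′ * ((n C k) * (n C l)))
    (sym (trans (cong (r *_) ab) (*-zeroʳ r))) (*-monoʳ-≤ k′ s)
lex-weak {suc n} {suc k} {suc l} r e x@(fill-left _) =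
  strong⇒weak (subst (suc k ≤_) (sym e) (m≤m+n _ _))
    (subst (suc l ≤_) (sym e) (≤-trans (m≤m+n (suc l) r) (m≤n+m _ (suc k)))) (lex-strong r e x)
lex-weak {suc n} {suc k} {suc l} r e x@(fill-right _) =
  strong⇒weak (subst (suc k ≤_) (sym e) (m≤m+n _ _))
    (subst (suc l ≤_) (sym e) (≤-trans (m≤m+n (suc l) r) (m≤n+m _ (suc k)))) (lex-strong r e x)

-- The product of the sizes

-- The slack e p b, where e = l - k > 0, also settles the equality case.
small-product : ∀ {k e r p L₀ L₁ a b} → let l = k + e in
  l * L₀ ≡ (k + r) * L₁ → a ≤ p →
  r * (a * b) + l * (a * L₀ + b * p) ≤ l * (p * L₀) →
  (k + r) * (a * (L₁ + b)) + e * (p * b) ≤ (k + r) * (p * L₁)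
small-product {k} {e} {r} {p} {L₀} {L₁} {a} {b} eL a≤p h = +-cancelʳ-≤ (k * (p * b)) _ _ (begin
  (k + r) * (a * (L₁ + b)) + e * (p * b) + k * (p * b)
    ≡⟨ ring₁ k e r p L₁ a b ⟩
  a * ((k + r) * L₁) + r * (a * b) + (k + e) * (b * p) + k * (a * b)
    ≡⟨ cong (λ u → a * u + r * (a * b) + (k + e) * (b * p) + k * (a * b)) (sym eL) ⟩
  a * ((k + e) * L₀) + r * (a * b) + (k + e) * (b * p) + k * (a * b)
    ≡⟨ ring₂ k e r p L₀ a b ⟩
  (r * (a * b) + (k + e) * (a * L₀ + b * p)) + k * (a * b)
    ≤⟨ +-mono-≤ h (*-monoʳ-≤ k (*-monoˡ-≤ b a≤p)) ⟩
  (k + e) * (p * L₀) + k * (p * b)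
    ≡⟨ cong (_+ k * (p * b)) (ring₃ (k + e) p L₀) ⟩
  p * ((k + e) * L₀) + k * (p * b)
    ≡⟨ cong (λ u → p * u + k * (p * b)) eL ⟩
  p * ((k + r) * L₁) + k * (p * b)
    ≡⟨ cong (_+ k * (p * b)) (ring₃ p (k + r) L₁) ⟩
  (k + r) * (p * L₁) + k * (p * b) ∎)
  where
  open ≤-Reasoning
  ring₁ : ∀ k e r p L₁ a b → (k + r) * (a * (L₁ + b)) + e * (p * b) + k * (p * b) ≡
    a * ((k + r) * L₁) + r * (a * b) + (k + e) * (b * p) + k * (a * b)
  ring₁ = solve-∀
  ring₂ : ∀ k e r p L₀ a b → a * ((k + e) * L₀) + r * (a * b) + (k + e) * (b * p) + k * (a * b) ≡
    (r * (a * b) + (k + e) * (a * L₀ + b * p)) + k * (a * b)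
  ring₂ = solve-∀
  ring₃ : ∀ x y z → x * (y * z) ≡ y * (x * z)
  ring₃ = solve-∀

-- Writing d = k + r + 1 and L₀ = b + Δ, the hypothesis on a and b reads a X ≤ k l p Δ for
-- X = k l L₀ + n r b; the two remaining hypotheses compare k l p (l L₀ + d b) with d E X
-- at b = 0 and at Δ = 0.
large-product-step : ∀ {k l r n p E Δ L₁ a b} → let d = suc k + r in
  n ≡ k + (l + r) → 0 < r → 0 < l → 0 < a → a ≤ p → 0 < b + Δ →
  l * (b + Δ) ≡ d * L₁ →
  n * (r * (a * b)) + k * l * (a * (b + Δ) + b * p) ≤ k * l * (p * (b + Δ)) →
  p * l < E * d →
  k * l * suc n * p ≤ E * (d * (k + r)) * (l + r) →
  (E + a) * (L₁ + b) < E * (L₁ + (b + Δ))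
large-product-step {zero} {l} {r@(suc _)} {n} {p} {E} {Δ} {L₁} {a@(suc a′)} {suc b} refl 0<r 0<l 0<a a≤p 0<L eL h h₁ h₂ =
  ⊥-elim (<⇒≱ (*-mono-< {0} {n} {0} (≤-trans 0<l (m≤m+n l r)) (*-mono-< {0} {r} {0} 0<r (s≤s z≤n)))
    (≤-trans (m≤m+n (n * (r * (a * suc b))) _) h))
-- For `k = 0` and `b = 0` the factor `X` cancelled in the main case is zero, so the products are
-- compared directly by means of `h₁`.
large-product-step {zero} {l} {r} {n} {p} {E} {Δ@(suc _)} {L₁} {a} {zero} e 0<r 0<l 0<a a≤p 0<L eL h h₁ h₂ =
  *-cancelˡ-< (suc r) _ _ (begin-strict
  suc r * ((E + a) * (L₁ + 0))   ≡⟨ ring₁ (suc r) E a L₁ ⟩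
  E * (suc r * L₁) + a * (suc r * L₁) ≡⟨ cong (λ u → E * (suc r * L₁) + a * u) (sym eL) ⟩
  E * (suc r * L₁) + a * (l * Δ) ≤⟨ +-monoʳ-≤ _ (*-monoˡ-≤ (l * Δ) a≤p) ⟩
  E * (suc r * L₁) + p * (l * Δ) ≡⟨ cong (E * (suc r * L₁) +_) (sym (*-assoc p l Δ)) ⟩
  E * (suc r * L₁) + p * l * Δ   <⟨ +-monoʳ-< (E * (suc r * L₁)) (*-monoˡ-< Δ h₁) ⟩
  E * (suc r * L₁) + E * suc r * Δ ≡⟨ ring₂ (suc r) E L₁ Δ ⟩
  suc r * (E * (L₁ + (0 + Δ)))   ∎)
  where
  open ≤-Reasoning
  ring₁ : ∀ d E a L → d * ((E + a) * (L + 0)) ≡ E * (d * L) + a * (d * L)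
  ring₁ = solve-∀
  ring₂ : ∀ d E L Δ → E * (d * L) + E * d * Δ ≡ d * (E * (L + Δ))
  ring₂ = solve-∀
large-product-step {suc k} {suc l} {r} {n} {p} {E} {zero} {L₁} {a@(suc _)} {b@(suc _)} e 0<r 0<l 0<a a≤p 0<L eL h h₁ h₂ =
  ⊥-elim (<⇒≱ (begin-strict
    suc k * suc l * (p * (b + 0)) ≡⟨ cong (suc k * suc l *_) (trans (cong (p *_) (+-identityʳ b)) (*-comm p b)) ⟩
    suc k * suc l * (b * p)
      <⟨ *-monoʳ-< (suc k * suc l) (m<n+m (b * p) (*-mono-< {0} {a} {0} {b + 0} (s≤s z≤n) (s≤s z≤n))) ⟩
    suc k * suc l * (a * (b + 0) + b * p) ≤⟨ m≤n+m _ _ ⟩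
    n * (r * (a * b)) + suc k * suc l * (a * (b + 0) + b * p) ∎) h)
  where open ≤-Reasoning
large-product-step {k@(suc _)} {l@(suc _)} {r} {n} {p} {E} {Δ@(suc _)} {L₁} {a} {b} refl 0<r 0<l 0<a a≤p 0<L eL h h₁ h₂ =
  *-cancelˡ-< d _ _ (begin-strict
  d * ((E + a) * (L₁ + b))
    ≡⟨ ring₁ d E a L₁ b ⟩
  E * (d * L₁) + d * (E * b) + a * (d * L₁ + d * b)
    ≡⟨ cong (λ u → E * (d * L₁) + d * (E * b) + a * (u + d * b)) (sym eL) ⟩
  E * (d * L₁) + d * (E * b) + a * Y
    <⟨ +-monoʳ-< (E * (d * L₁) + d * (E * b)) main ⟩
  E * (d * L₁) + d * (E * b) + d * (E * Δ)
    ≡⟨ ring₂ d E L₁ b Δ ⟩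
  d * (E * (L₁ + (b + Δ))) ∎)
  where
  open ≤-Reasoning
  d = suc k + r
  X = k * l * (b + Δ) + n * (r * b)
  Y = l * (b + Δ) + d * b
  ring₁ : ∀ d E a L b → d * ((E + a) * (L + b)) ≡ E * (d * L) + d * (E * b) + a * (d * L + d * b)
  ring₁ = solve-∀
  ring₂ : ∀ d E L b Δ → E * (d * L) + d * (E * b) + d * (E * Δ) ≡ d * (E * (L + (b + Δ)))
  ring₂ = solve-∀
  ring₃ : ∀ n r a b k l p Δ → a * (k * l * (b + Δ) + n * (r * b)) + k * l * (b * p) ≡
    n * (r * (a * b)) + k * l * (a * (b + Δ) + b * p)
  ring₃ = solve-∀
  ring₄ : ∀ k l p b Δ → k * l * (p * (b + Δ)) ≡ k * l * p * Δ + k * l * (b * p)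
  ring₄ = solve-∀
  ring₅ : ∀ k l r p b Δ → k * l * p * (l * (b + Δ) + (suc k + r) * b) ≡
    k * l * (p * l) * Δ + k * l * suc (k + (l + r)) * p * b
  ring₅ = solve-∀
  ring₆ : ∀ k l r E b Δ → k * l * (E * (suc k + r)) * Δ + E * ((suc k + r) * (k + r)) * (l + r) * b ≡
    (k * l * (b + Δ) + (k + (l + r)) * (r * b)) * (E * (suc k + r))
  ring₆ = solve-∀
  aX : a * X ≤ k * l * p * Δ
  aX = +-cancelʳ-≤ (k * l * (b * p)) _ _
    (subst₂ _≤_ (sym (ring₃ n r a b k l p Δ)) (ring₄ k l p b Δ) h)
  klpY : k * l * p * Y < X * (E * d)
  klpY = begin-strict
    k * l * p * Y
      ≡⟨ ring₅ k l r p b Δ ⟩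
    k * l * (p * l) * Δ + k * l * suc n * p * b
      <⟨ +-mono-<-≤ (*-monoˡ-< Δ (*-monoʳ-< (k * l) h₁)) (*-monoˡ-≤ b h₂) ⟩
    k * l * (E * d) * Δ + E * (d * (k + r)) * (l + r) * b
      ≡⟨ ring₆ k l r E b Δ ⟩
    X * (E * d) ∎
  main : a * Y < d * (E * Δ)
  main = *-cancelˡ-< X _ _ (begin-strict
    X * (a * Y)          ≡⟨ swap X a Y ⟩
    a * X * Y            ≤⟨ *-monoˡ-≤ Y aX ⟩
    k * l * p * Δ * Y    ≡⟨ swap′ (k * l * p) Δ Y ⟩
    k * l * p * Y * Δ    <⟨ *-monoˡ-< Δ klpY ⟩
    X * (E * d) * Δ      ≡⟨ swap″ X E d Δ ⟩
    X * (d * (E * Δ))    ∎)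
    where
    swap : ∀ x y z → x * (y * z) ≡ y * x * z
    swap = solve-∀
    swap′ : ∀ x y z → x * y * z ≡ x * z * y
    swap′ = solve-∀
    swap″ : ∀ x y z w → x * (y * z) * w ≡ x * (z * (y * w))
    swap″ = solve-∀

-- The next star has size `p′`, and the total of the full stars grows from `E` to `E + p`. Once the
-- gains from `l < suc l` and `E ≤ E + p` are given away, what remains is `(v + 1)² ≤ v (n + 1)`;
-- since `n = k + v + 1`, this says `1 ≤ k v`.
square-condition-step : ∀ k {l v n p p′ E Z} → 0 < v → n ≡ suc (k + v) → n * p′ ≡ suc v * p →
  k * suc l * suc n * p ≤ E * Z * suc v → k * l * n * p′ ≤ (E + p) * Z * v
square-condition-step zero _ _ _ _ = z≤n
square-condition-step k@(suc k′) {l} {v@(suc v′)} {n} {p} {p′} {E} {Z} _ refl eq h = *-cancelˡ-≤ (suc n) (begin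
  suc n * (k * l * n * p′)      ≡⟨ ring₁ (suc n) k l n p′ ⟩
  suc n * (k * l * (n * p′))    ≡⟨ cong (λ u → suc n * (k * l * u)) eq ⟩
  suc n * (k * l * (suc v * p)) ≡⟨ ring₂ (suc n) k l (suc v) p ⟩
  suc v * (k * l * suc n * p)
    ≤⟨ *-monoʳ-≤ (suc v) (*-monoˡ-≤ p (*-monoˡ-≤ (suc n) (*-monoʳ-≤ k (n≤1+n l)))) ⟩
  suc v * (k * suc l * suc n * p) ≤⟨ *-monoʳ-≤ (suc v) h ⟩
  suc v * (E * Z * suc v)       ≡⟨ ring₃ (suc v) E Z ⟩
  E * Z * (suc v * suc v)       ≤⟨ *-monoʳ-≤ (E * Z) (≤-trans (m≤m+n _ (v′ + k′ * v′ + k′)) (≤-reflexive (ring₄ k′ v′))) ⟩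
  E * Z * (v * suc n)           ≤⟨ *-monoˡ-≤ (v * suc n) (*-monoˡ-≤ Z (m≤m+n E p)) ⟩
  (E + p) * Z * (v * suc n)     ≡⟨ ring₅ (suc n) ((E + p) * Z) v ⟩
  suc n * ((E + p) * Z * v)     ∎)
  where
  open ≤-Reasoning
  ring₁ : ∀ N k l n p → N * (k * l * n * p) ≡ N * (k * l * (n * p))
  ring₁ = solve-∀
  ring₂ : ∀ N k l v p → N * (k * l * (v * p)) ≡ v * (k * l * N * p)
  ring₂ = solve-∀
  ring₃ : ∀ v E Z → v * (E * Z * v) ≡ E * Z * (v * v)
  ring₃ = solve-∀
  ring₄ : ∀ k v → suc (suc v) * suc (suc v) + (v + k * v + k) ≡ suc v * suc (suc (suc k + suc v))
  ring₄ = solve-∀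
  ring₅ : ∀ N x v → x * (v * N) ≡ N * (x * v)
  ring₅ = solve-∀

-- `E` is the total size of the stars already full, `a` what has been added since. Inside the
-- current star `large-product-step` applies. If that star is full too, its size moves into `E`, and
-- the induction compares with this larger union before `descent` compares with the old one.
large-product : ∀ {n l a b} k r E → n ≡ suc k + (l + r) → 0 < r → Lex n (suc k) l a b → 0 < a →
  ((k + (l + r)) C k) * l < E * (suc k + r) →
  k * l * n * ((k + (l + r)) C k) ≤ E * ((suc k + r) * (k + r)) * (l + r) →
  (E + a) * b < E * (n C l)
large-product {n} {l} {a} {b} k r E e 0<r (trivial ab _ _) 0<a h₁ _ with m*n≡0⇒m≡0∨n≡0 a ab
... | inj₁ refl = ⊥-elim (n≮0 0<a)
... | inj₂ refl = subst (_< E * (n C l)) (sym (*-zeroʳ (E + a)))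
        (*-mono-< {0} {E} (0<E E h₁) (C-pos (subst (l ≤_) (sym e) (≤-trans (m≤m+n l r) (m≤n+m _ (suc k))))))
  where
  0<E : ∀ {x} E → x < E * (suc k + r) → 0 < E
  0<E (suc E) _ = s≤s z≤n
large-product k r E refl 0<r (fill-right {n} {l = l} {a} {b} x) 0<a h₁ h₂
  with b | n C suc l ∸ b | m+[n∸m]≡n (Lex-right-bound x) | lex-strong r refl x
... | b | Δ | eq | strong = subst (λ u → (E + a) * (n C l + b) < E * u)
        (trans (cong (n C l +_) eq) (sym (pascal n l)))
        (large-product-step {k} {suc l} {r} {n} {E = E} refl 0<r (s≤s z≤n) 0<a (Lex-left-bound x)
          (subst (0 <_) (sym eq) (C-pos (≤-trans (m≤m+n (suc l) r) (m≤n+m _ k))))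
          (trans (cong (suc l *_) eq) ratio)
          (subst (λ u → n * (r * (a * b)) + k * suc l * (a * u + b * (n C k)) ≤ k * suc l * ((n C k) * u)) (sym eq) strong)
          h₁ h₂)
  where
  rotate : ∀ k l r → k + (suc l + r) ≡ l + (suc k + r)
  rotate = solve-∀
  ratio : suc l * ((k + (suc l + r)) C suc l) ≡ (suc k + r) * ((k + (suc l + r)) C l)
  ratio = trans (cong (λ m → suc l * (m C suc l)) (rotate k l r))
    (trans (C-ratio l (suc k + r)) (cong (λ m → (suc k + r) * (m C l)) (sym (rotate k l r))))
large-product k r E e 0<r (fill-left {n} {l = l} {a} {b} x) 0<a h₁ h₂ = go a x
  where
  open ≤-Reasoning
  n≡ : n ≡ k + (suc l + r)
  n≡ = suc-injective e
  p = n C k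
  h₁′ : p * suc l < E * (suc k + r)
  h₁′ = subst (λ m → (m C k) * suc l < E * (suc k + r)) (sym n≡) h₁
  h₂′ : k * suc l * suc n * p ≤ E * ((suc k + r) * (k + r)) * (suc l + r)
  h₂′ = subst (λ m → k * suc l * suc n * (m C k) ≤ E * ((suc k + r) * (k + r)) * (suc l + r)) (sym n≡) h₂
  sum-eq : ∀ E k l r → E * (suc k + r) + E * l ≡ E * (suc k + (l + r))
  sum-eq = solve-∀
  -- Completing one more star loses: after clearing binomials the claim is
  -- `(E + p)(l + 1) < E (n + 1)`, which is `h₁′` with `E (l + 1)` added.
  descent : (E + p) * (n C l) < E * (suc n C suc l)
  descent = *-cancelˡ-< (suc n) _ _ (begin-strict
    suc n * ((E + p) * (n C l))   ≡⟨ swap (suc n) (E + p) (n C l) ⟩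
    (E + p) * (suc n * (n C l))   ≡⟨ cong ((E + p) *_) (sym (absorb n l)) ⟩
    (E + p) * (suc l * Q)         ≡⟨ *-assoc (E + p) (suc l) Q ⟨
    (E + p) * suc l * Q           ≡⟨ cong (_* Q) (*-distribʳ-+ (suc l) E p) ⟩
    (E * suc l + p * suc l) * Q   <⟨ *-monoˡ-< Q {{>-nonZero (C-pos l≤n)}} (+-monoʳ-< (E * suc l) h₁′) ⟩
    (E * suc l + E * (suc k + r)) * Q ≡⟨ cong (_* Q) (trans (+-comm (E * suc l) _) (sum-eq E k (suc l) r)) ⟩
    E * (suc k + (suc l + r)) * Q ≡⟨ cong (λ u → E * u * Q) (sym e) ⟩
    E * suc n * Q                 ≡⟨ swap′ E (suc n) Q ⟩
    suc n * (E * Q)               ∎)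
    where
    Q = suc n C suc l
    l≤n : suc l ≤ suc n
    l≤n = subst (suc l ≤_) (sym e) (≤-trans (m≤m+n (suc l) r) (m≤n+m _ (suc k)))
    swap : ∀ x y z → x * (y * z) ≡ y * (x * z)
    swap = solve-∀
    swap′ : ∀ x y z → x * y * z ≡ y * (x * z)
    swap′ = solve-∀
  p′ = (k + (l + r)) C k
  p′≤p : p′ ≤ p
  p′≤p = subst (λ m → p′ ≤ m C k) (sym (trans n≡ (+-suc k (l + r)))) (C-mono (k + (l + r)) k)
  next₁ : p′ * l < (E + p) * (suc k + r)
  next₁ = begin-strict
    p′ * l              ≤⟨ *-mono-≤ p′≤p (n≤1+n l) ⟩
    p * suc l           <⟨ h₁′ ⟩
    E * (suc k + r)     ≤⟨ *-monoˡ-≤ (suc k + r) (m≤m+n E p) ⟩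
    (E + p) * (suc k + r) ∎
  v = l + r
  Z = (suc k + r) * (k + r)
  n≡′ : n ≡ suc (k + v)
  n≡′ = trans n≡ (+-suc k v)
  shrink : n * p′ ≡ suc v * p
  shrink = trans (cong (_* p′) n≡′) (trans (C-shrink k v) (cong (λ m → suc v * (m C k)) (sym n≡′)))
  next₂ : k * l * n * p′ ≤ (E + p) * Z * v
  next₂ = square-condition-step k {l} {v} {p = p} {E = E} {Z} (≤-trans 0<r (m≤n+m r l)) n≡′ shrink h₂′
  go : ∀ a → Lex n (suc k) l a b → (E + (p + a)) * b < E * (suc n C suc l)
  go zero x = begin-strict
    (E + (p + 0)) * b   ≡⟨ cong (λ u → (E + u) * b) (+-identityʳ p) ⟩
    (E + p) * b         ≤⟨ *-monoʳ-≤ (E + p) (Lex-right-bound x) ⟩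
    (E + p) * (n C l)   <⟨ descent ⟩
    E * (suc n C suc l) ∎
  go (suc a) x = begin-strict
    (E + (p + suc a)) * b ≡⟨ cong (_* b) (sym (+-assoc E p (suc a))) ⟩
    (E + p + suc a) * b   <⟨ large-product k r (E + p) (trans n≡ (+-suc k (l + r))) 0<r x (s≤s z≤n) next₁ next₂ ⟩
    (E + p) * (n C l)     <⟨ descent ⟩
    E * (suc n C suc l)   ∎

-- Families with the smallest possible shadow

no-members : ∀ {n} {F : Family n} → card F ≡ 0 → ∀ A → ¬ T (F A)
no-members {n} {F} c A t = ⊑-antisym-card {F = λ _ → false} {F} (λ _ ()) (subst (_≤ _) (sym c) z≤n) A t

-- The case `r = 1` of the density bound. If the partner size `b` is positive, the term `r a b`
-- makes the normalized matching inequality strict; if `b = 0`, the shadow is already the whole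
-- level.
strict-lym : ∀ n k s {y} → n ≡ k + suc s → 0 < y → y ≤ n C k →
  n C s ≤ sh n (suc s) y ⊎ y * (n C s) < sh n (suc s) y * (n C k)
strict-lym n k s {y} e 0<y y≤ with lex n k s 1 (trans e (cong (k +_) (+-comm 1 s))) y y≤
... | zero , x , h = inj₁ (subst (λ u → n C s ≤ D n u s y) (+-comm s 1) h)
... | b@(suc _) , x , h = inj₂ (+-cancelˡ-< (b * K) _ _ (begin-strict
    b * K + y * L        ≡⟨ +-comm (b * K) _ ⟩
    y * L + b * K        <⟨ *-cancelˡ-< k _ _ (≤-trans (+-monoˡ-≤ _ (*-mono-< {0} {1} {0} (s≤s z≤n) (*-mono-< {0} {y} {0} 0<y (s≤s z≤n)))) (Weak.left≤ w)) ⟩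
    K * L                ≤⟨ *-monoʳ-≤ K (subst (λ u → L ≤ b + D n u s y) (+-comm s 1) h) ⟩
    K * (b + sh n (suc s) y) ≡⟨ trans (*-comm K _) (*-distribʳ-+ K b _) ⟩
    b * K + sh n (suc s) y * K ∎))
  where
  open ≤-Reasoning
  K = n C k
  L = n C s
  w = lex-weak 1 (trans e (cong (k +_) (+-comm 1 s))) x

-- The densities of the two segments add up to one, and passing to the shadow strictly raises each
-- of them unless that shadow is full, in which case the other one is an excess.
sh-strictly-subadditive : ∀ n s {x y} → 0 < x → 0 < y → x + y ≡ n C suc s →
  n C s < sh n (suc s) x + sh n (suc s) y
sh-strictly-subadditive n s {x} {y} 0<x 0<y e with suc s ≤? n
... | no s≰n = ⊥-elim (<⇒≢ (≤-trans 0<x (m≤m+n x y)) (sym (trans e (C-zero (≰⇒> s≰n)))))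
... | yes s≤n = combine (strict-lym n k s n≡ 0<x (≤-trans (m≤m+n x y) x+y≤)) (strict-lym n k s n≡ 0<y (≤-trans (m≤n+m y x) x+y≤))
  where
  open ≤-Reasoning
  k = n ∸ suc s
  n≡ : n ≡ k + suc s
  n≡ = sym (m∸n+n≡m s≤n)
  K≡ : x + y ≡ n C k
  K≡ = trans e (trans (cong (_C suc s) n≡) (trans (C-sym k (suc s)) (cong (_C k) (sym n≡))))
  x+y≤ : x + y ≤ n C k
  x+y≤ = ≤-reflexive K≡
  combine : n C s ≤ sh n (suc s) x ⊎ x * (n C s) < sh n (suc s) x * (n C k) →
    n C s ≤ sh n (suc s) y ⊎ y * (n C s) < sh n (suc s) y * (n C k) →
    n C s < sh n (suc s) x + sh n (suc s) y
  combine (inj₁ p) _ = <-≤-trans (m<m+n (n C s) (sh-pos n s 0<y (subst (y ≤_) e (m≤n+m y x)))) (+-monoˡ-≤ _ p)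
  combine (inj₂ _) (inj₁ q) = <-≤-trans (m<n+m (n C s) (sh-pos n s 0<x (subst (x ≤_) e (m≤m+n x y)))) (+-monoʳ-≤ _ q)
  combine (inj₂ p) (inj₂ q) = *-cancelʳ-< (n C k) _ _ (begin-strict
    (n C s) * (n C k)           ≡⟨ *-comm (n C s) (n C k) ⟩
    (n C k) * (n C s)           ≡⟨ cong (_* (n C s)) (sym K≡) ⟩
    (x + y) * (n C s)           ≡⟨ *-distribʳ-+ (n C s) x y ⟩
    x * (n C s) + y * (n C s)   <⟨ +-mono-< p q ⟩
    sh n (suc s) x * (n C k) + sh n (suc s) y * (n C k) ≡⟨ *-distribʳ-+ (n C k) (sh n (suc s) x) _ ⟨
    (sh n (suc s) x + sh n (suc s) y) * (n C k) ∎)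

Avoids : ∀ {n} → Fin n → Family n → Set
Avoids v F = ∀ A → T (F A) → v ∉ A

Contains : ∀ {n} → Fin n → Family n → Set
Contains v F = ∀ A → T (F A) → v ∈ A

Shadow-mono : ∀ {n} {F F′ G G′ : Family n} → F ⊑ F′ → G ⊑ G′ → Shadow F′ G → Shadow F G′
Shadow-mono {zero} _ _ _ = tt
Shadow-mono {suc n} p q (a , b , c) =
  (λ A t → q (outside ∷ A) (a A (p (inside ∷ A) t))) ,
  Shadow-mono (p ∘ (outside ∷_)) (q ∘ (outside ∷_)) b ,
  Shadow-mono (p ∘ (inside ∷_)) (q ∘ (inside ∷_)) c

Shadow-empty : ∀ {n} {F G : Family n} → (∀ A → ¬ T (F A)) → Shadow F G
Shadow-empty {zero} _ = tt
Shadow-empty {suc n} h =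
  (λ A t → ⊥-elim (h (inside ∷ A) t)) , Shadow-empty (h ∘ (outside ∷_)) , Shadow-empty (h ∘ (inside ∷_))

Shadow-full : ∀ {n} {F : Family n} → Shadow F (λ _ → true)
Shadow-full {zero} = tt
Shadow-full {suc n} = (λ _ _ → tt) , Shadow-full , Shadow-full

T-not : ∀ {n} {v : Fin n} {A} → v ∉ A → T (not (lookup A v))
T-not {v = v} {A} v∉A with lookup A v in eq
... | false = tt
... | true = v∉A (lookup⇒[]= v A eq)

not-T : ∀ {n} {v : Fin n} {A} → T (not (lookup A v)) → v ∉ A
not-T {v = v} {A} t v∈A = subst (T ∘ not) ([]=⇒lookup v∈A) t

Shadow-avoiding : ∀ {n} (v : Fin n) {F : Family n} → Avoids v F → Shadow F (λ A → not (lookup A v))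
Shadow-avoiding zero h = (λ _ _ → tt) , Shadow-full , Shadow-empty (λ A t → h (inside ∷ A) t here)
Shadow-avoiding (suc v) h =
  (λ A t → T-not (h (inside ∷ A) t ∘ there)) ,
  Shadow-avoiding v (λ A t → h (outside ∷ A) t ∘ there) ,
  Shadow-avoiding v (λ A t → h (inside ∷ A) t ∘ there)

-- The members of `G` that avoid `v` still contain the shadow of `F`, so by Kruskal-Katona there are
-- at least `n C s` of them, and `G` has no room for others.
avoids-shadow : ∀ {n} s v {F G : Family (suc n)} → suc s ≤ n → Uniform (suc s) F → Avoids v F →
  card F ≡ n C suc s → Shadow F G → card G ≤ n C s → Avoids v G
avoids-shadow {n} s v {F} {G} s<n u h c sF g A t =
  not-T (proj₂ (∧⁻ (⊑-antisym-card {F = G ⊓ᶠ V} {G} (λ _ → proj₁ ∘ ∧⁻) (≤-trans g lower) A t)))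
  where
  V : Family (suc n)
  V A = not (lookup A v)
  lower : n C s ≤ card (G ⊓ᶠ V)
  lower = subst (_≤ card (G ⊓ᶠ V))
    (trans (cong (sh (suc n) (suc s)) c) (trans (sh-low n (suc s) ≤-refl) (D-full n (n≤1+n s) s<n)))
    (kruskal-katona (suc s) u (Shadow-mono {F = F} {F ⊓ᶠ F} {G ⊓ᶠ V} (λ _ x → ∧⁺ x x) (λ _ x → x)
      (Shadow-⊓ {F = F} {F} {G} {V} sF (Shadow-avoiding v h))))

-- Only two sizes of `F ¹` survive. If it exceeds `n C s`, then `G ⁰ ⊒ F ¹` and the shadow of `F ¹`
-- are together too large. If it is positive and smaller, `F ⁰` exceeds `n C suc s` by the missing
-- amount, and `sh-strictly-subadditive` makes the shadow too large. Size zero gives the first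
-- point, and size `n C s` leads to the induction.
extremal-shadow : ∀ n s {F G : Family (suc n)} → Uniform (suc s) F → card F ≡ n C suc s →
  Shadow F G → card G ≤ n C s → ∃[ v ] Avoids v F
extremal-shadow zero s {F} u c _ _ = zero , λ A t → ⊥-elim (no-members {F = F} c A t)
extremal-shadow (suc n) s {F} {G} u c (F¹⊑G⁰ , s₀ , s₁) g = by-section (card (F ¹)) refl
  where
  open ≤-Reasoning
  u₀ = uniform⁰ {F = F} u
  u₁ = uniform¹ {F = F} u
  total : card (F ⁰) + card (F ¹) ≡ n C suc s + n C s
  total = trans (sym (card-suc F)) (trans c (trans (pascal n s) (+-comm (n C s) _)))
  g⁰ : card (F ¹) ≤ card (G ⁰)
  g⁰ = card-mono F¹⊑G⁰
  g¹ : sh (suc n) s (card (F ¹)) ≤ card (G ¹)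
  g¹ = kruskal-katona s u₁ s₁
  g≤ : card (G ⁰) + card (G ¹) ≤ suc n C s
  g≤ = subst (_≤ suc n C s) (card-suc G) g
  extend : ∀ v → Avoids v (F ⁰) → Avoids v (F ¹) → ∃[ v ] Avoids v F
  extend v p q = suc v , λ { (outside ∷ A) t → p A t ∘ drop-there ; (inside ∷ A) t → q A t ∘ drop-there }

  -- If `n < suc s`, then `F ⁰` is empty and provides no point, so the induction goes into `F ¹`.
  -- For `s = 0` the only possible member of `F ¹` is the empty set, and any point serves.
  degenerate : ∀ s → card (F ⁰) ≡ 0 → Uniform s (F ¹) → card (F ¹) ≡ n C s →
    card (G ⁰) + card (G ¹) ≤ suc n C s → ∃[ v ] Avoids v F
  degenerate zero c₀ u₁ _ _ = extend zero (λ A t → ⊥-elim (no-members c₀ A t))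
    (λ A t v∈A → n≮0 (subst (∣ (A - zero) ∣ <_) (u₁ A t) (x∈p⇒∣p-x∣<∣p∣ v∈A)))
  degenerate (suc s) c₀ u₁ c₁ h = let w , q = extremal-shadow n s u₁ c₁ s₁ G¹≤ in
    extend w (λ A t → ⊥-elim (no-members c₀ A t)) q
    where
    G¹≤ : card (G ¹) ≤ n C s
    G¹≤ = +-cancelˡ-≤ (n C suc s) _ _ (begin
      n C suc s + card (G ¹)    ≤⟨ +-monoˡ-≤ (card (G ¹)) (subst (_≤ card (G ⁰)) c₁ g⁰) ⟩
      card (G ⁰) + card (G ¹)   ≤⟨ h ⟩
      suc n C suc s             ≡⟨ trans (pascal n s) (+-comm (n C s) _) ⟩
      n C suc s + n C s         ∎)

  balanced : card (F ¹) ≡ n C s → card (F ⁰) ≡ n C suc s → 0 < n C s → ∃[ v ] Avoids v F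
  balanced c₁ c₀ 0<C with suc s ≤? n
  ... | yes s<n = let v , p = extremal-shadow n s u₀ c₀ s₀ G⁰≤ in
          -- The point found for `F ⁰` also serves `F ¹`, because `F ¹ ⊑ G ⁰` and `G ⁰` avoids it.
          extend v p (λ A t → avoids-shadow s v s<n u₀ p c₀ s₀ G⁰≤ A (F¹⊑G⁰ A t))
    where
    G⁰≤ : card (G ⁰) ≤ n C s
    G⁰≤ = bound s s<n c₁ g¹ g≤
      where
      bound : ∀ s → suc s ≤ n → card (F ¹) ≡ n C s → sh (suc n) s (card (F ¹)) ≤ card (G ¹) →
        card (G ⁰) + card (G ¹) ≤ suc n C s → card (G ⁰) ≤ n C s
      bound zero _ _ _ h = ≤-trans (m≤m+n _ _) h
      bound (suc s) s<n c₁ g¹ h = +-cancelʳ-≤ (n C s) _ _ (begin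
        card (G ⁰) + n C s      ≡⟨ cong (card (G ⁰) +_) (sym (D-full n (n≤1+n s) (<⇒≤ s<n))) ⟩
        card (G ⁰) + sh n (suc s) (n C suc s) ≡⟨ cong (card (G ⁰) +_) (sym (sh-low n (suc s) ≤-refl)) ⟩
        card (G ⁰) + sh (suc n) (suc s) (n C suc s) ≡⟨ cong (λ x → card (G ⁰) + sh (suc n) (suc s) x) (sym c₁) ⟩
        card (G ⁰) + sh (suc n) (suc s) (card (F ¹)) ≤⟨ +-monoʳ-≤ (card (G ⁰)) g¹ ⟩
        card (G ⁰) + card (G ¹) ≤⟨ h ⟩
        suc n C suc s           ≡⟨ trans (pascal n s) (+-comm (n C s) _) ⟩
        n C suc s + n C s       ∎)
  ... | no s≮n = degenerate s (trans c₀ (C-zero (≰⇒> s≮n))) u₁ c₁ g≤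

  too-large : ∀ s {y} → 0 < y → card (F ¹) ≡ n C s + y → card (F ¹) ≤ suc n C s →
    sh (suc n) s (card (F ¹)) ≤ card (G ¹) → card (G ⁰) + card (G ¹) ≤ suc n C s → ⊥
  too-large zero 0<y c₁ F¹≤ _ _ = <⇒≱ (m<m+n 1 0<y) (subst (_≤ 1) c₁ F¹≤)
  too-large (suc s) {y} 0<y c₁ _ g¹ h = <⇒≱ (begin-strict
    suc n C suc s           ≡⟨ trans (pascal n s) (+-comm (n C s) _) ⟩
    n C suc s + n C s       <⟨ +-monoˡ-< (n C s) (m<m+n (n C suc s) 0<y) ⟩
    n C suc s + y + n C s   ≤⟨ +-monoʳ-≤ (n C suc s + y) (m≤m+n (n C s) (sh n s y)) ⟩
    n C suc s + y + (n C s + sh n s y) ≡⟨ cong₂ _+_ (sym c₁) (sym (trans (cong (sh (suc n) (suc s)) c₁) (sh-high n s 0<y))) ⟩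
    card (F ¹) + sh (suc n) (suc s) (card (F ¹)) ≤⟨ +-mono-≤ g⁰ g¹ ⟩
    card (G ⁰) + card (G ¹) ∎) h

  too-small : ∀ s {x y} → 0 < x → 0 < y → x + y ≡ n C s → card (F ⁰) ≡ n C suc s + y → card (F ¹) ≡ x →
    sh (suc n) (suc s) (card (F ⁰)) ≤ card (G ⁰) → sh (suc n) s (card (F ¹)) ≤ card (G ¹) →
    card (G ⁰) + card (G ¹) ≤ suc n C s → ⊥
  too-small zero {suc x} {suc y} _ _ e _ _ _ _ _ = 0≢1+n (sym (suc-injective (trans (sym (cong suc (+-suc x y))) e)))
  too-small (suc s) {x} {y} 0<x 0<y e c₀ c₁ g⁰ g¹ h = <⇒≱ (begin-strict
    suc n C suc s           ≡⟨ trans (pascal n s) (+-comm (n C s) _) ⟩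
    n C suc s + n C s       <⟨ +-monoʳ-< (n C suc s) (sh-strictly-subadditive n s 0<y 0<x (trans (+-comm y x) e)) ⟩
    n C suc s + (sh n (suc s) y + sh n (suc s) x) ≡⟨ +-assoc (n C suc s) _ _ ⟨
    n C suc s + sh n (suc s) y + sh n (suc s) x
      ≡⟨ cong₂ _+_ (sym (trans (cong (sh (suc n) (suc (suc s))) c₀) (sh-high n (suc s) 0<y)))
           (sym (trans (cong (sh (suc n) (suc s)) c₁) (sh-low n (suc s) (subst (x ≤_) e (m≤m+n x y))))) ⟩
    sh (suc n) (suc (suc s)) (card (F ⁰)) + sh (suc n) (suc s) (card (F ¹)) ≤⟨ +-mono-≤ g⁰ g¹ ⟩
    card (G ⁰) + card (G ¹) ∎) h

  by-section : ∀ x → card (F ¹) ≡ x → ∃[ v ] Avoids v F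
  by-section zero c₁ = zero , λ { (outside ∷ A) t () ; (inside ∷ A) t _ → no-members c₁ A t }
  by-section x@(suc _) c₁ with <-cmp x (n C s)
  ... | tri< lt _ _ = ⊥-elim (too-small s {x} {n C s ∸ x} (s≤s z≤n) (m<n⇒0<n∸m lt) (m+[n∸m]≡n (<⇒≤ lt))
          (+-cancelʳ-≡ x _ _ (begin-equality
            card (F ⁰) + x           ≡⟨ cong (card (F ⁰) +_) (sym c₁) ⟩
            card (F ⁰) + card (F ¹)  ≡⟨ total ⟩
            n C suc s + n C s        ≡⟨ cong (n C suc s +_) (sym (m∸n+n≡m (<⇒≤ lt))) ⟩
            n C suc s + (n C s ∸ x + x) ≡⟨ +-assoc (n C suc s) _ x ⟨
            n C suc s + (n C s ∸ x) + x ∎))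
          c₁ (kruskal-katona (suc s) u₀ s₀) g¹ g≤)
  ... | tri≈ _ x≡ _ = balanced (trans c₁ x≡)
          (+-cancelʳ-≡ (n C s) _ _ (trans (cong (card (F ⁰) +_) (sym (trans c₁ x≡))) total))
          (subst (0 <_) x≡ (s≤s z≤n))
  ... | tri> _ _ gt = ⊥-elim (too-large s (m<n⇒0<n∸m gt) (trans c₁ (sym (m+[n∸m]≡n (<⇒≤ gt)))) (card≤C s u₁) g¹ g≤)

-- From cross-intersecting families to shadows

shadow : ∀ {n} → Family n → Family n
shadow F [] = false
shadow F (outside ∷ A) = shadow (F ⁰) A ∨ (F ¹) A
shadow F (inside ∷ A) = shadow (F ¹) A

shadow-Shadow : ∀ {n} (F : Family n) → Shadow F (shadow F)
shadow-Shadow {zero} F = tt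
shadow-Shadow {suc n} F =
  (λ A t → ∨⁺ʳ t) ,
  Shadow-mono {F = F ⁰} (λ _ t → t) (λ A t → ∨⁺ˡ t) (shadow-Shadow (F ⁰)) ,
  shadow-Shadow (F ¹)

shadow-origin : ∀ {n} (F : Family n) A → T (shadow F A) → ∃[ B ] (T (F B) × A ⊆ B × ∣ B ∣ ≡ suc ∣ A ∣)
shadow-origin F (outside ∷ A) t with ∨⁻ t
... | inj₁ s = let B , f , A⊆B , e = shadow-origin (F ⁰) A s in
        outside ∷ B , f , (λ { (there x∈A) → there (A⊆B x∈A) }) , e
... | inj₂ f = inside ∷ A , f , (λ { (there x∈A) → there x∈A }) , refl
shadow-origin F (inside ∷ A) t = let B , f , A⊆B , e = shadow-origin (F ¹) A t in
  inside ∷ B , f , (λ { here → here ; (there x∈A) → there (A⊆B x∈A) }) , cong suc e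

shadows : ∀ {n} → ℕ → Family n → Family n
shadows zero F = F
shadows (suc r) F = shadows r (shadow F)

shadow-uniform : ∀ {n s} {F : Family n} → Uniform (suc s) F → Uniform s (shadow F)
shadow-uniform {F = F} u A t = let B , f , _ , e = shadow-origin F A t in suc-injective (trans (sym e) (u B f))

shadows-uniform : ∀ {n} r {l} {F : Family n} → Uniform (r + l) F → Uniform l (shadows r F)
shadows-uniform zero u = u
shadows-uniform (suc r) {F = F} u = shadows-uniform r (shadow-uniform {F = F} u)

shadows-origin : ∀ {n} r (F : Family n) A → T (shadows r F A) → ∃[ B ] (T (F B) × A ⊆ B)
shadows-origin zero F A t = A , t , id
shadows-origin (suc r) F A t =
  let B , s , A⊆B = shadows-origin r (shadow F) A t
      B′ , f , B⊆B′ , _ = shadow-origin F B s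
  in B′ , f , B⊆B′ ∘ A⊆B

shadows-card : ∀ {n} r {l} {F : Family n} → Uniform (r + l) F → D n (r + l) l (card F) ≤ card (shadows r F)
shadows-card {n} zero {l} {F} u = ≤-reflexive (D-id n l (card≤C l {F} u))
shadows-card {n} (suc r) {l} {F} u = begin
  D n (suc (r + l)) l (card F)
    ≡⟨ D-comp n (m≤n+m l r) (card≤C _ {F} u) ⟨
  D n (r + l) l (D n (suc (r + l)) (r + l) (card F))
    ≤⟨ D-mono n (m≤n+m l r) (kruskal-katona (suc (r + l)) {F} u (shadow-Shadow F)) (card≤C (r + l) {shadow F} u′) ⟩
  D n (r + l) l (card (shadow F))
    ≤⟨ shadows-card r {F = shadow F} u′ ⟩
  card (shadows r (shadow F)) ∎
  where
  open ≤-Reasoning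
  u′ : Uniform (r + l) (shadow F)
  u′ = shadow-uniform {F = F} u

card-∁ : ∀ {n} (F : Family n) → card (F ∘ ∁) ≡ card F
card-∁ {zero} F = refl
card-∁ {suc n} F = trans (card-suc (F ∘ ∁)) (trans (cong₂ _+_ (card-∁ (F ¹)) (card-∁ (F ⁰)))
  (trans (+-comm (card (F ¹)) _) (sym (card-suc F))))

uniform-∁ : ∀ {n k s} {F : Family n} → n ≡ k + s → Uniform k F → Uniform s (F ∘ ∁)
uniform-∁ {n} {k} {s} refl u A t = +-cancelˡ-≡ k _ _ (trans (cong (_+ ∣ A ∣) (sym (trans (sym (∣∁p∣≡n∸∣p∣ A)) (u (∁ A) t))))
  (m∸n+n≡m (∣p∣≤n A)))

∁-involutive : ∀ {n} (A : Subset n) → ∁ (∁ A) ≡ A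
∁-involutive [] = refl
∁-involutive (outside ∷ A) = cong (outside ∷_) (∁-involutive A)
∁-involutive (inside ∷ A) = cong (inside ∷_) (∁-involutive A)

member-nonempty : ∀ {n} {v : Fin n} {A : Subset n} → v ∈ A → ¬ (∣ A ∣ ≡ 0)
member-nonempty {v = v} {A} v∈A e = n≮0 (subst (∣ (A - v) ∣ <_) e (x∈p⇒∣p-x∣<∣p∣ v∈A))

-- Stars and their sizes

contains-card : ∀ {n} k (v : Fin (suc n)) {F : Family (suc n)} → Uniform (suc k) F → Contains v F → card F ≤ n C k
contains-card {n} k zero {F} u h = subst (_≤ n C k)
  (sym (trans (card-suc F) (cong (_+ card (F ¹)) (card-empty {F = F ⁰} (λ A t → out (h (outside ∷ A) t))))))
  (card≤C k (uniform¹ {F = F} u))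
  where
  out : ∀ {n} {A : Subset n} → zero ∉ outside ∷ A
  out ()
contains-card {suc n} zero (suc v) {F} u h = subst₂ _≤_ (sym (card-suc F)) (+-identityʳ 1)
  (+-mono-≤ (contains-card 0 v (uniform⁰ {F = F} u) (λ A t → drop-there (h (outside ∷ A) t)))
    (≤-reflexive (card-empty {F = F ¹} (λ A t → member-nonempty (drop-there (h (inside ∷ A) t)) (uniform¹ {F = F} u A t)))))
contains-card {suc n} (suc k) (suc v) {F} u h = subst₂ _≤_ (sym (card-suc F)) (trans (+-comm (n C suc k) _) (sym (pascal n k)))
  (+-mono-≤ (contains-card (suc k) v (uniform⁰ {F = F} u) (λ A t → drop-there (h (outside ∷ A) t)))
    (contains-card k v (uniform¹ {F = F} u) (λ A t → drop-there (h (inside ∷ A) t))))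

avoids-card : ∀ {n} l (v : Fin (suc n)) {F : Family (suc n)} → Uniform l F → Avoids v F → card F ≤ n C l
avoids-card {n} l zero {F} u h = subst (_≤ n C l)
  (sym (trans (card-suc F) (trans (cong (_+_ (card (F ⁰))) (card-empty {F = F ¹} (λ A t → h (inside ∷ A) t here))) (+-identityʳ _))))
  (card≤C l (uniform⁰ {F = F} u))
avoids-card {suc n} zero (suc v) {F} u h = card≤C 0 {F} u
avoids-card {suc n} (suc l) (suc v) {F} u h = subst₂ _≤_ (sym (card-suc F)) (trans (+-comm (n C suc l) _) (sym (pascal n l)))
  (+-mono-≤ (avoids-card (suc l) v (uniform⁰ {F = F} u) (λ A t → h (outside ∷ A) t ∘ there))
    (avoids-card l v (uniform¹ {F = F} u) (λ A t → h (inside ∷ A) t ∘ there)))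

sized : ∀ {n} → ℕ → Family n → Family n
sized k P A = (∣ A ∣ ≡ᵇ k) ∧ P A

sized-uniform : ∀ {n} k (P : Family n) → Uniform k (sized k P)
sized-uniform k P A t = ≡ᵇ⇒≡ ∣ A ∣ k (proj₁ (∧⁻ t))

sized-full-card : ∀ n k → card {n} (sized k (λ _ → true)) ≡ n C k
sized-full-card zero zero = refl
sized-full-card zero (suc k) = refl
sized-full-card (suc n) zero = trans (card-suc {n} (sized 0 (λ _ → true)))
  (cong₂ _+_ (sized-full-card n 0) (card-empty {n} (λ _ ())))
sized-full-card (suc n) (suc k) = trans (card-suc {n} (sized (suc k) (λ _ → true)))
  (trans (cong₂ _+_ (sized-full-card n (suc k)) (sized-full-card n k))
    (trans (+-comm (n C suc k) _) (sym (pascal n k))))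

star : ∀ {n} → ℕ → Fin n → Family n
star k v = sized k (λ A → lookup A v)

T-lookup : ∀ {n} {v : Fin n} {A} → v ∈ A → T (lookup A v)
T-lookup v∈A = subst T (sym ([]=⇒lookup v∈A)) tt

lookup-T : ∀ {n} {v : Fin n} {A} → T (lookup A v) → v ∈ A
lookup-T {v = v} {A} t = lookup⇒[]= v A (Equivalence.to T-≡ t)

star-contains : ∀ {n} k (v : Fin n) → Contains v (star k v)
star-contains k v A t = lookup-T (proj₂ (∧⁻ t))

star-zero-card : ∀ n k → card (star {suc n} (suc k) zero) ≡ n C k
star-zero-card n k = trans (card-suc {n} (star (suc k) zero))
  (trans (cong (_+ card (star {suc n} (suc k) zero ¹)) (card-empty {n} {star (suc k) zero ⁰} (λ A t → proj₂ (∧⁻ {∣ A ∣ ≡ᵇ suc k} t))))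
    (sized-full-card n k))

full-star : ∀ {n} k (v : Fin (suc n)) {F : Family (suc n)} → Uniform (suc k) F → Contains v F → n C k ≤ card F →
  ∀ A → ∣ A ∣ ≡ suc k → v ∈ A → T (F A)
full-star k v {F} u h c A e v∈A = ⊑-antisym-card
  (λ B t → ∧⁺ (≡⇒≡ᵇ ∣ B ∣ (suc k) (u B t)) (T-lookup (h B t)))
  (≤-trans (contains-card k v (sized-uniform (suc k) _) (star-contains (suc k) v)) c)
  A (∧⁺ (≡⇒≡ᵇ ∣ A ∣ (suc k) e) (T-lookup v∈A))

-- The maximal product and its uniqueness

-- Here `k` and `l` are one less than the set sizes of the theorem. Multiplied by `p` and divided by
-- `N`, the two numerical hypotheses become the starting conditions of `large-product` for `E = p`,
-- a single full star.
lex-product : ∀ {k l r a b} → k < l → 0 < r →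
  l * (suc l + r) < suc (k + (l + r)) * (suc k + r) →
  k * l * (suc l + r) ≤ (suc k + r) * (k + r) * (l + r) →
  Lex (suc (suc (k + (l + r)))) (suc k) (suc l) a b →
  let p = suc (k + (l + r)) C k ; q = suc (k + (l + r)) C l in
  a * b ≤ p * q × (a * b ≡ p * q → a ≡ p × b ≡ q)
lex-product {k} {l} {r} {a} {b} k<l 0<r h₁ h₂ x = cases x
  where
  open ≤-Reasoning
  N = suc (k + (l + r))
  p = N C k
  q = N C l
  0<p : 0 < p
  0<p = C-pos (≤-trans (m≤m+n k _) (n≤1+n _))
  0<q : 0 < q
  0<q = C-pos (≤-trans (≤-trans (m≤m+n l r) (m≤n+m _ k)) (n≤1+n _))
  p′ = (k + (l + r)) C k
  shrink : N * p′ ≡ suc (l + r) * p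
  shrink = C-shrink k (l + r)
  cond₁ : p′ * l < p * (suc k + r)
  cond₁ = *-cancelˡ-< N _ _ (begin-strict
    N * (p′ * l)               ≡⟨ *-assoc N p′ l ⟨
    N * p′ * l                 ≡⟨ cong (_* l) shrink ⟩
    suc (l + r) * p * l        ≡⟨ ring₁ (suc (l + r)) p l ⟩
    p * (l * (suc l + r))      <⟨ *-monoʳ-< p {{>-nonZero 0<p}} h₁ ⟩
    p * (N * (suc k + r))      ≡⟨ ring₂ p N (suc k + r) ⟩
    N * (p * (suc k + r))      ∎)
    where
    ring₁ : ∀ x p l → x * p * l ≡ p * (l * x)
    ring₁ = solve-∀
    ring₂ : ∀ p N d → p * (N * d) ≡ N * (p * d)
    ring₂ = solve-∀
  cond₂ : k * l * N * p′ ≤ p * ((suc k + r) * (k + r)) * (l + r)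
  cond₂ = begin
    k * l * N * p′             ≡⟨ *-assoc (k * l) N p′ ⟩
    k * l * (N * p′)           ≡⟨ cong (k * l *_) shrink ⟩
    k * l * (suc (l + r) * p)  ≡⟨ ring₁ (k * l) (suc (l + r)) p ⟩
    p * (k * l * (suc l + r))  ≤⟨ *-monoʳ-≤ p h₂ ⟩
    p * ((suc k + r) * (k + r) * (l + r)) ≡⟨ *-assoc p ((suc k + r) * (k + r)) (l + r) ⟨
    p * ((suc k + r) * (k + r)) * (l + r) ∎
    where
    ring₁ : ∀ x y p → x * (y * p) ≡ p * (x * y)
    ring₁ = solve-∀
  cases : ∀ {a b} → Lex (suc N) (suc k) (suc l) a b → a * b ≤ p * q × (a * b ≡ p * q → a ≡ p × b ≡ q)
  cases (trivial ab _ _) = subst (_≤ p * q) (sym ab) z≤n ,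
    λ e → ⊥-elim (<⇒≢ (*-mono-< {0} {p} {0} 0<p 0<q) (trans (sym ab) e))
  -- Exactly one star is full; equality in the product then forces `ℬ` to have all `q` members.
  cases (fill-left {a = zero} {b} x) rewrite +-identityʳ p = *-monoʳ-≤ p (Lex-right-bound x) ,
    λ e → refl , *-cancelˡ-≡ b q p {{>-nonZero 0<p}} e
  cases (fill-left {a = suc a} {b} x) = <⇒≤ lt , λ e → ⊥-elim (<⇒≢ lt e)
    where lt = large-product k r p refl 0<r x (s≤s z≤n) cond₁ cond₂
  cases (fill-right {a = a} {b} x) = ≤pq , eq
    where
    e = l ∸ k
    l≡ : suc k + e ≡ suc l
    l≡ = cong suc (m+[n∸m]≡n (<⇒≤ k<l))
    N≡ : N ≡ k + (suc l + r)
    N≡ = sym (+-suc k (l + r))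
    rotate : ∀ k l r → suc (k + (l + r)) ≡ l + (suc k + r)
    rotate = solve-∀
    ratio : suc l * (N C suc l) ≡ (suc k + r) * q
    ratio = trans (cong (λ m → suc l * (m C suc l)) (rotate k l r))
      (trans (C-ratio l (suc k + r)) (cong (λ m → (suc k + r) * (m C l)) (sym (rotate k l r))))
    slack : (suc k + r) * (a * (q + b)) + e * (p * b) ≤ (suc k + r) * (p * q)
    slack = small-product {suc k} {e} {r} {p} {N C suc l} {q} {a} {b}
      (trans (cong (_* (N C suc l)) l≡) ratio) (Lex-left-bound x)
      (subst (λ u → r * (a * b) + u * (a * (N C suc l) + b * p) ≤ u * (p * (N C suc l))) (sym l≡)
        (Weak.right≤ (lex-weak r N≡ x)))
    ≤pq : a * (q + b) ≤ p * q
    ≤pq = *-cancelˡ-≤ (suc k + r) (≤-trans (m≤m+n _ _) slack)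
    b≡0 : a * (q + b) ≡ p * q → b ≡ 0
    b≡0 eq with m*n≡0⇒m≡0∨n≡0 e (n≤0⇒n≡0 (+-cancelˡ-≤ ((suc k + r) * (p * q)) _ _
      (subst₂ _≤_ (cong (λ u → (suc k + r) * u + e * (p * b)) eq) (sym (+-identityʳ _)) slack)))
    ... | inj₁ e≡0 = ⊥-elim (<⇒≢ (m<n⇒0<n∸m k<l) (sym e≡0))
    ... | inj₂ pb≡0 with m*n≡0⇒m≡0∨n≡0 p pb≡0
    ...   | inj₁ p≡0 = ⊥-elim (<⇒≢ 0<p (sym p≡0))
    ...   | inj₂ b≡0 = b≡0
    eq : a * (q + b) ≡ p * q → a ≡ p × q + b ≡ q
    eq h = *-cancelʳ-≡ a p q {{>-nonZero 0<q}} (trans (cong (a *_) (sym q≡)) h) , q≡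
      where
      q≡ : q + b ≡ q
      q≡ = trans (cong (q +_) (b≡0 h)) (+-identityʳ q)

module _ {n k l} r {𝒜 ℬ : Family n} (e : n ≡ k + (r + l))
  (u𝒜 : Uniform k 𝒜) (uℬ : Uniform l ℬ) (ci : CrossIntersecting 𝒜 ℬ) where

  co : Family n
  co = 𝒜 ∘ ∁

  co-uniform : Uniform (r + l) co
  co-uniform = uniform-∁ e u𝒜

  shadows-disjoint : ∀ A → T (shadows r co A) → ¬ T (ℬ A)
  shadows-disjoint A t b =
    let B , f , A⊆B = shadows-origin r co A t
        x , x∈∁B , x∈A = ci (∁ B) A f b
    in x∈∁p⇒x∉p x∈∁B (A⊆B x∈A)

  card-shadows : card ℬ + card (shadows r co) ≤ n C l
  card-shadows = subst (_≤ n C l)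
    (trans (cong (_+ card (ℬ ⊔ᶠ shadows r co)) (sym (card-empty {F = ℬ ⊓ᶠ shadows r co} (λ A t → shadows-disjoint A (proj₂ (∧⁻ {ℬ A} t)) (proj₁ (∧⁻ t))))))
      (card-⊓⊔ ℬ (shadows r co)))
    (card≤C l {ℬ ⊔ᶠ shadows r co} union)
    where
    union : Uniform l (ℬ ⊔ᶠ shadows r co)
    union A t with ∨⁻ {ℬ A} t
    ... | inj₁ b = uℬ A b
    ... | inj₂ s = shadows-uniform r co-uniform A s

  D-cross : card ℬ + D n (r + l) l (card 𝒜) ≤ n C l
  D-cross = ≤-trans (+-monoʳ-≤ (card ℬ)
    (subst (λ x → D n (r + l) l x ≤ card (shadows r co)) (card-∁ 𝒜) (shadows-card r {F = co} co-uniform))) card-shadows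

  cross-lex : ∃[ b ] (Lex n k l (card 𝒜) b × card ℬ ≤ b)
  cross-lex =
    let b , x , h = lex n k l r (trans e (cong (k +_) (+-comm r l))) (card 𝒜) (card≤C k u𝒜)
        D′ = subst (λ s → n C l ≤ b + D n s l (card 𝒜)) (+-comm l r) h
    in b , x , +-cancelʳ-≤ (D n (r + l) l (card 𝒜)) _ _ (≤-trans D-cross D′)

extremal-common-star : ∀ {N k l} r {𝒜 ℬ : Family (suc N)} → N ≡ k + (suc r + suc l) →
  Uniform (suc k) 𝒜 → Uniform (suc l) ℬ → CrossIntersecting 𝒜 ℬ →
  card 𝒜 ≡ N C k → card ℬ ≡ N C l → CommonStar (suc k) (suc l) 𝒜 ℬ
extremal-common-star {N} {k} {l} r {𝒜} {ℬ} e u𝒜 uℬ ci c𝒜 cℬ = v ,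
  (λ A → mk⇔ (λ t → u𝒜 A t , 𝒜∋v A t) (λ (s , m) → full-star k v u𝒜 𝒜∋v (≤-reflexive (sym c𝒜)) A s m)) ,
  (λ B → mk⇔ (λ t → uℬ B t , ℬ∋v B t) (λ (s , m) → full-star l v uℬ ℬ∋v (≤-reflexive (sym cℬ)) B s m))
  where
  open ≤-Reasoning
  n = suc N
  e′ : n ≡ suc k + (suc r + suc l)
  e′ = cong suc e
  -- s + 1 is the size of the complements of the members of 𝒜.
  s = r + suc l
  F = 𝒜 ∘ ∁
  uF : Uniform (suc s) F
  uF = co-uniform (suc r) e′ u𝒜 uℬ ci
  Δ = shadows (suc r) F
  s≤N : suc s ≤ N
  s≤N = subst (suc s ≤_) (sym e) (m≤n+m (suc s) k)
  cF : card F ≡ N C suc s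
  cF = trans (card-∁ 𝒜) (trans c𝒜 (trans (cong (_C k) e) (trans (sym (C-sym k (suc s))) (cong (_C suc s) (sym e)))))
  Δ≤ : card Δ ≤ N C suc l
  Δ≤ = +-cancelˡ-≤ (N C l) _ _ (subst₂ _≤_ (cong (_+ card Δ) cℬ) (pascal N l) (card-shadows (suc r) e′ u𝒜 uℬ ci))
  G = shadow F
  uG : Uniform s G
  uG = shadow-uniform {F = F} uF
  -- Only the `suc r`-fold shadow is known to be small. If the first shadow had more than `N C s`
  -- members, a colexicographic segment of that size would reach sets through the top point, and its
  -- `r` further shadows would have more than `N C suc l` members.
  G≤ : card G ≤ N C s
  G≤ with split (N C s) (card G)
  ... | low p = p
  ... | high y 0<y c = ⊥-elim (<⇒≱ (begin-strict
          N C suc l              <⟨ m<m+n (N C suc l) (D-pos N (m≤n+m l r) 0<y y≤) ⟩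
          N C suc l + D N (r + l) l y
            ≡⟨ D-high+ N (r + l) (suc l) 0<y ⟨
          D n (suc (r + l)) (suc l) (N C suc (r + l) + y)
            ≡⟨ cong₂ (λ t x → D n t (suc l) x) (sym (+-suc r l)) (sym c′) ⟩
          D n s (suc l) (card G) ≤⟨ shadows-card r {F = G} uG ⟩
          card Δ                 ∎) Δ≤)
    where
    c′ : card G ≡ N C suc (r + l) + y
    c′ = trans c (cong (λ t → N C t + y) (+-suc r l))
    y≤ : y ≤ N C (r + l)
    y≤ = peel N (r + l) (subst₂ _≤_ c′ (cong (n C_) (+-suc r l)) (card≤C s {G} uG))
  avoided : ∃[ v ] Avoids v F
  avoided = extremal-shadow N s uF cF (shadow-Shadow F) G≤
  v = proj₁ avoided
  𝒜∋v : Contains v 𝒜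
  𝒜∋v A t = x∉∁p⇒x∈p (proj₂ avoided (∁ A) (subst (T ∘ 𝒜) (sym (∁-involutive A)) t))
  Δ∌v : Avoids v Δ
  Δ∌v A t v∈A = let B , f , A⊆B = shadows-origin (suc r) F A t in proj₂ avoided B f (A⊆B v∈A)
  uΔ : Uniform (suc l) Δ
  uΔ = shadows-uniform (suc r) {F = F} uF
  Δ≥ : N C suc l ≤ card Δ
  Δ≥ = subst (_≤ card Δ)
    (trans (cong (D n (suc s) (suc l)) cF) (trans (D-low {N} {s} {suc l} ≤-refl) (D-full N (≤-trans (m≤n+m (suc l) r) (n≤1+n s)) s≤N)))
    (shadows-card (suc r) {F = F} uF)
  missing : Family n
  missing = sized (suc l) (λ B → not (lookup B v))
  -- `Δ` avoids `v` and is at least as large as the family of all such sets of its size, so it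
  -- contains each of them. A member of `ℬ` without `v` would therefore lie in `Δ`, which is
  -- disjoint from `ℬ`.
  missing⊑Δ : missing ⊑ Δ
  missing⊑Δ = ⊑-antisym-card
    (λ B t → ∧⁺ (≡⇒≡ᵇ ∣ B ∣ (suc l) (uΔ B t)) (T-not (Δ∌v B t)))
    (≤-trans (avoids-card (suc l) v (sized-uniform (suc l) _) (λ B t → not-T (proj₂ (∧⁻ {∣ B ∣ ≡ᵇ suc l} t)))) Δ≥)
  ℬ∋v : Contains v ℬ
  ℬ∋v B t with v ∈? B
  ... | yes m = m
  ... | no v∉B = ⊥-elim (shadows-disjoint (suc r) e′ u𝒜 uℬ ci B
          (missing⊑Δ B (∧⁺ (≡⇒≡ᵇ ∣ B ∣ (suc l) (uℬ B t)) (T-not v∉B))) t)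

stars-cross : ∀ {n} k l → CrossIntersecting (star {suc n} k zero) (star l zero)
stars-cross k l A B s t = zero , star-contains k zero A s , star-contains l zero B t

cross-intersecting-product : ∀ k l r → k < l → 0 < r →
  l * (suc l + r) < suc (k + (l + r)) * (suc k + r) →
  k * l * (suc l + r) ≤ (suc k + r) * (k + r) * (l + r) →
  let N = suc (k + (l + r)) in
  (∀ (𝒜 ℬ : Family (suc N)) → Uniform (suc k) 𝒜 → Uniform (suc l) ℬ → CrossIntersecting 𝒜 ℬ →
    card 𝒜 * card ℬ ≤ (N C k) * (N C l)) ×
  (∀ (𝒜 ℬ : Family (suc N)) → Uniform (suc k) 𝒜 → Uniform (suc l) ℬ → CrossIntersecting 𝒜 ℬ →
    card 𝒜 * card ℬ ≡ (N C k) * (N C l) → CommonStar (suc k) (suc l) 𝒜 ℬ)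
cross-intersecting-product k l r@(suc r′) k<l 0<r h₁ h₂ = bound , unique
  where
  N = suc (k + (l + r))
  e : N ≡ k + (r + suc l)
  e = trans (sym (+-suc k (l + r))) (cong (k +_) (+-comm (suc l) r))
  bound : ∀ (𝒜 ℬ : Family (suc N)) → Uniform (suc k) 𝒜 → Uniform (suc l) ℬ → CrossIntersecting 𝒜 ℬ →
    card 𝒜 * card ℬ ≤ (N C k) * (N C l)
  bound 𝒜 ℬ u𝒜 uℬ ci =
    let b , x , ℬ≤b = cross-lex r (cong suc e) u𝒜 uℬ ci
    in ≤-trans (*-monoʳ-≤ (card 𝒜) ℬ≤b) (proj₁ (lex-product k<l 0<r h₁ h₂ x))
  unique : ∀ (𝒜 ℬ : Family (suc N)) → Uniform (suc k) 𝒜 → Uniform (suc l) ℬ → CrossIntersecting 𝒜 ℬ →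
    card 𝒜 * card ℬ ≡ (N C k) * (N C l) → CommonStar (suc k) (suc l) 𝒜 ℬ
  unique 𝒜 ℬ u𝒜 uℬ ci eq = extremal-common-star r′ e u𝒜 uℬ ci 𝒜≡ ℬ≡
    where
    lexed = cross-lex r (cong suc e) u𝒜 uℬ ci
    product = lex-product k<l 0<r h₁ h₂ (proj₁ (proj₂ lexed))
    𝒜≡ : card 𝒜 ≡ N C k
    𝒜≡ = proj₁ (proj₂ product (≤-antisym (proj₁ product)
      (≤-trans (≤-reflexive (sym eq)) (*-monoʳ-≤ (card 𝒜) (proj₂ (proj₂ lexed))))))
    ℬ≡ : card ℬ ≡ N C l
    ℬ≡ = *-cancelˡ-≡ _ _ (N C k) {{>-nonZero (C-pos (≤-trans (m≤m+n k (l + r)) (n≤1+n _)))}}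
      (trans (cong (_* card ℬ) (sym 𝒜≡)) eq)

shape : ∀ n k l → 0 < k → n < 2 * l → k + l < n →
  ∃[ k′ ] ∃[ l′ ] ∃[ r ] (k ≡ suc k′ × l ≡ suc l′ × n ≡ suc (suc (k′ + (l′ + r))) × k′ < l′ × 0 < r)
shape n (suc k) zero _ n<2l _ = ⊥-elim (n≮0 n<2l)
shape n (suc k) (suc l) _ n<2l k+l<n =
  k , l , r , refl , refl , n≡ , s≤s⁻¹ (+-cancelʳ-< (suc l) (suc k) (suc l) k+l<l+l) , m<n⇒0<n∸m k+l<n
  where
  r = n ∸ (suc k + suc l)
  rearrange : ∀ k l r → suc k + suc l + r ≡ suc (suc (k + (l + r)))
  rearrange = solve-∀
  n≡ : n ≡ suc (suc (k + (l + r)))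
  n≡ = trans (sym (m+[n∸m]≡n (<⇒≤ k+l<n))) (rearrange k l r)
  k+l<l+l : suc k + suc l < suc l + suc l
  k+l<l+l = <-trans k+l<n (subst (n <_) (cong (λ x → suc l + x) (+-identityʳ (suc l))) n<2l)

open import Data.Integer using (+_)
open import Data.Rational using (1ℚ; 0ℚ) renaming (_+_ to _+ℚ_; _*_ to _*ℚ_; _-_ to _-ℚ_; _<_ to _<ℚ_; _/_ to _/ℚ_)
open import Data.Rational.Base as ℚ using (ℚ; toℚᵘ)
open import Data.Rational.Unnormalised using (mkℚᵘ; _≃_; *<*)
import Data.Integer as ℤ
import Data.Integer.Properties as ℤ
import Data.Rational.Properties as ℚ
import Data.Rational.Unnormalised.Properties as ℚᵘ

-- The hypotheses of the theorem as inequalities between natural numbers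

-- Their quotient is `1/(a+1) + ... + 1/(a+c)`, not reduced, with the product of the terms'
-- denominators below. The shift by one keeps these denominators positive for every `a`.
harmNum harmDen : ℕ → ℕ → ℕ
harmNum a zero = 0
harmNum a (suc c) = harmDen (suc a) c + suc a * harmNum (suc a) c
harmDen a zero = 1
harmDen a (suc c) = suc a * harmDen (suc a) c

harmDen-pos : ∀ a c → 0 < harmDen a c
harmDen-pos a zero = s≤s z≤n
harmDen-pos a (suc c) = ≤-trans (harmDen-pos (suc a) c) (m≤m+n _ _)

-- Each of the `c` summands is at least the last one, `1/(a+c)`.
harm-lower : ∀ a c → c * harmDen a c ≤ (a + c) * harmNum a c
harm-lower a zero = z≤n
harm-lower a (suc c) = begin
  suc c * (suc a * d)                      ≡⟨ ring₁ a c d ⟩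
  suc a * d + suc a * (c * d)              ≤⟨ +-mono-≤ (*-monoˡ-≤ d (m≤m+n (suc a) c)) (*-monoʳ-≤ (suc a) (harm-lower (suc a) c)) ⟩
  (suc a + c) * d + suc a * ((suc a + c) * n) ≡⟨ ring₂ a c d n ⟩
  (a + suc c) * (d + suc a * n)            ∎
  where
  open ≤-Reasoning
  d = harmDen (suc a) c
  n = harmNum (suc a) c
  ring₁ : ∀ a c d → suc c * (suc a * d) ≡ suc a * d + suc a * (c * d)
  ring₁ = solve-∀
  ring₂ : ∀ a c d n → (suc a + c) * d + suc a * ((suc a + c) * n) ≡ (a + suc c) * (d + suc a * n)
  ring₂ = solve-∀

frac-trans : ∀ {x y z w u v} → 0 < w → x * w ≤ z * y → z * v ≤ u * w → x * v ≤ u * y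
frac-trans {x} {y} {z} {w} {u} {v} 0<w p q = *-cancelˡ-≤ w {{>-nonZero 0<w}} (begin
  w * (x * v)  ≡⟨ ring₁ w x v ⟩
  x * w * v    ≤⟨ *-monoˡ-≤ v p ⟩
  z * y * v    ≡⟨ ring₂ z y v ⟩
  z * v * y    ≤⟨ *-monoˡ-≤ y q ⟩
  u * w * y    ≡⟨ ring₃ u w y ⟩
  w * (u * y)  ∎)
  where
  open ≤-Reasoning
  ring₁ : ∀ w x v → w * (x * v) ≡ x * w * v
  ring₁ = solve-∀
  ring₂ : ∀ z y v → z * y * v ≡ z * v * y
  ring₂ = solve-∀
  ring₃ : ∀ u w y → u * w * y ≡ w * (u * y)
  ring₃ = solve-∀

-- For a fixed last index, a times the mean of 1/(a+1), 1/(a+2), ... is nondecreasing in a;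
-- this removes the logarithm-like sums from the second hypothesis of the theorem.
harm-mean-mono : ∀ g a c → 0 < c →
  a * harmNum a (g + c) * (c * harmDen (a + g) c) ≤ (a + g) * harmNum (a + g) c * ((g + c) * harmDen a (g + c))
harm-mean-mono zero a c _ rewrite +-identityʳ a = ≤-refl
harm-mean-mono (suc g) a c 0<c rewrite +-suc a g = frac-trans
  {a * harmNum a (suc (g + c))} {suc (g + c) * harmDen a (suc (g + c))} {suc a * n} {(g + c) * d}
  {suc (a + g) * harmNum (suc (a + g)) c} {c * harmDen (suc (a + g)) c}
  (*-mono-< {0} {g + c} {0} (≤-trans 0<c (m≤n+m c g)) (harmDen-pos (suc a) (g + c)))
  step (harm-mean-mono g (suc a) c 0<c)
  where
  open ≤-Reasoning
  e = g + c
  d = harmDen (suc a) e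
  n = harmNum (suc a) e
  ring₁ : ∀ a e d n → a * (d + suc a * n) * (e * d) ≡ (a * (e * d) + a * e * (suc a * n)) * d
  ring₁ = solve-∀
  ring₂ : ∀ a e d n → (suc a * ((suc a + e) * n) + a * e * (suc a * n)) * d ≡ suc a * n * (suc e * (suc a * d))
  ring₂ = solve-∀
  -- With `S = n/d`, the sum without its first term `1/(a+1)`, the claim reduces to
  -- `a e / (a+1) ≤ (a+1+e) S`, and `harm-lower` gives even `e ≤ (a+1+e) S`.
  step : a * (d + suc a * n) * (e * d) ≤ suc a * n * (suc e * (suc a * d))
  step = begin
    a * (d + suc a * n) * (e * d)
      ≡⟨ ring₁ a e d n ⟩
    (a * (e * d) + a * e * (suc a * n)) * d
      ≤⟨ *-monoˡ-≤ d (+-monoˡ-≤ (a * e * (suc a * n)) (*-mono-≤ (n≤1+n a) (harm-lower (suc a) e))) ⟩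
    (suc a * ((suc a + e) * n) + a * e * (suc a * n)) * d
      ≡⟨ ring₂ a e d n ⟩
    suc a * n * (suc e * (suc a * d)) ∎

-- The hypothesis compares two sums with the same last index. `harm-mean-mono` bounds the longer one
-- by a multiple of the shorter one, and the positive shorter sum then cancels, leaving a polynomial
-- inequality.
square-condition : ∀ k l r →
  (suc l + r) * (harmNum (k + r) l * harmDen k (r + l)) < (suc k + r) * (harmNum k (r + l) * harmDen (k + r) l) →
  k * l * (suc l + r) ≤ (suc k + r) * (k + r) * (l + r)
square-condition k zero r _ rewrite *-zeroʳ k = z≤n
square-condition k l@(suc l′) r h = *-cancelʳ-≤ _ _ X {{>-nonZero 0<X}} (begin
  k * l * (suc l + r) * X       ≡⟨ *-assoc (k * l) (suc l + r) X ⟩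
  k * l * ((suc l + r) * X)     ≤⟨ *-monoʳ-≤ (k * l) (<⇒≤ h) ⟩
  k * l * (d * Y)               ≡⟨ ring₁ k l d N₁ D₂ ⟩
  d * (k * N₁ * (l * D₂))       ≤⟨ *-monoʳ-≤ d (harm-mean-mono r k l (s≤s z≤n)) ⟩
  d * ((k + r) * N₂ * ((r + l) * D₁)) ≡⟨ ring₂ k l r d N₂ D₁ ⟩
  d * (k + r) * (l + r) * X     ∎)
  where
  open ≤-Reasoning
  d = suc k + r
  N₁ = harmNum k (r + l)
  D₁ = harmDen k (r + l)
  N₂ = harmNum (k + r) l
  D₂ = harmDen (k + r) l
  X = N₂ * D₁
  Y = N₁ * D₂
  0<X : 0 < X
  0<X = *-mono-< {0} {N₂} {0} (≤-trans (harmDen-pos (suc (k + r)) l′) (m≤m+n _ _)) (harmDen-pos k (r + l))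
  ring₁ : ∀ k l d N D → k * l * (d * (N * D)) ≡ d * (k * N * (l * D))
  ring₁ = solve-∀
  ring₂ : ∀ k l r d N D → d * ((k + r) * N * ((r + l) * D)) ≡ d * (k + r) * (l + r) * (N * D)
  ring₂ = solve-∀

-- Rational inequalities as inequalities between fractions of natural numbers

-- The representation is up to equality of unnormalised rationals, so no fraction has to be reduced.
-- The index is a successor because `mkℚᵘ` stores the denominator minus one.
data _≐_/_ (q : ℚ) (a : ℕ) : ℕ → Set where
  rep : ∀ {b} → toℚᵘ q ≃ mkℚᵘ (+ a) b → q ≐ a / suc b

≐-over : ∀ a b → (a over suc b) ≐ a / suc b
≐-over a b = rep (ℚ.toℚᵘ-fromℚᵘ (mkℚᵘ (+ a) b))

≐-/1 : ∀ a → ((+ a) /ℚ 1) ≐ a / 1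
≐-/1 a = ≐-over a 0

≐-+ : ∀ {p q a b c d} → p ≐ a / b → q ≐ c / d → (p +ℚ q) ≐ (a * d + c * b) / (b * d)
≐-+ {p} {q} {a} {c = c} (rep {b} x) (rep {d} y) = rep (ℚᵘ.≃-trans (ℚ.toℚᵘ-homo-+ p q)
  (ℚᵘ.≃-trans (ℚᵘ.+-cong x y) (ℚᵘ.≃-reflexive (cong (λ u → mkℚᵘ u (d + b * suc d)) num))))
  where
  num : + a ℤ.* + suc d ℤ.+ + c ℤ.* + suc b ≡ + (a * suc d + c * suc b)
  num = trans (cong₂ ℤ._+_ (sym (ℤ.pos-* a (suc d))) (sym (ℤ.pos-* c (suc b)))) (sym (ℤ.pos-+ (a * suc d) (c * suc b)))

≐-* : ∀ {p q a b c d} → p ≐ a / b → q ≐ c / d → (p *ℚ q) ≐ (a * c) / (b * d)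
≐-* {p} {q} {a} {c = c} (rep {b} x) (rep {d} y) = rep (ℚᵘ.≃-trans (ℚ.toℚᵘ-homo-* p q)
  (ℚᵘ.≃-trans (ℚᵘ.*-cong x y) (ℚᵘ.≃-reflexive (cong (λ u → mkℚᵘ u (d + b * suc d)) (sym (ℤ.pos-* a c))))))

≐-< : ∀ {p q a b c d} → p ≐ a / b → q ≐ c / d → p <ℚ q → a * d < c * b
≐-< {p} {q} {a} {c = c} (rep {b} x) (rep {d} y) h with ℚᵘ.<-respˡ-≃ x (ℚᵘ.<-respʳ-≃ y (ℚ.toℚᵘ-mono-< h))
... | *<* lt = ℤ.drop‿+<+ (subst₂ ℤ._<_ (sym (ℤ.pos-* a (suc d))) (sym (ℤ.pos-* c (suc b))) lt)

≐-harm : ∀ a c → harmAux (suc a) c ≐ harmNum a c / harmDen a c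
≐-harm a zero = rep ℚᵘ.≃-refl
≐-harm a (suc c) = subst (λ u → harmAux (suc a) (suc c) ≐ u / harmDen a (suc c))
  (cong₂ _+_ (+-identityʳ (harmDen (suc a) c)) (*-comm (harmNum (suc a) c) (suc a)))
  (≐-+ (≐-over 1 a) (≐-harm (suc a) c))

-- Clearing denominators gives `(N + (l + r + 1)) l < N²`, and `N = l + (k + r + 1)` allows `N l` to
-- be cancelled.
first-condition : ∀ k l r →
  ((1ℚ +ℚ ((suc l + r) over suc (k + (l + r)))) *ℚ (l over suc (k + (l + r)))) <ℚ 1ℚ →
  l * (suc l + r) < suc (k + (l + r)) * (suc k + r)
first-condition k l r h = +-cancelˡ-< (N * l) _ _ (subst₂ _<_ (ring₁ N l r) (ring₂ k l r)
  (≐-< (≐-* (≐-+ (≐-/1 1) (≐-over (suc l + r) (k + (l + r)))) (≐-over l (k + (l + r)))) (≐-/1 1) h))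
  where
  N = suc (k + (l + r))
  ring₁ : ∀ N l r → (1 * N + (suc l + r) * 1) * l * 1 ≡ N * l + l * (suc l + r)
  ring₁ = solve-∀
  ring₂ : ∀ k l r → let N = suc (k + (l + r)) in 1 * (1 * N * N) ≡ N * l + N * (suc k + r)
  ring₂ = solve-∀

second-condition : ∀ k l r →
  (((+ (suc l + r)) /ℚ 1) *ℚ harmAux (suc (k + r)) l) -ℚ (((+ (suc k + r)) /ℚ 1) *ℚ harmAux (suc k) (r + l)) <ℚ 0ℚ →
  (suc l + r) * (harmNum (k + r) l * harmDen k (r + l)) < (suc k + r) * (harmNum k (r + l) * harmDen (k + r) l)
second-condition k l r h = subst₂ _<_ (ring (suc l + r) (harmNum (k + r) l) (harmDen k (r + l)))
  (ring (suc k + r) (harmNum k (r + l)) (harmDen (k + r) l))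
  (≐-< (≐-* (≐-/1 (suc l + r)) (≐-harm (k + r) l)) (≐-* (≐-/1 (suc k + r)) (≐-harm k (r + l))) p<q)
  where
  p = ((+ (suc l + r)) /ℚ 1) *ℚ harmAux (suc (k + r)) l
  q = ((+ (suc k + r)) /ℚ 1) *ℚ harmAux (suc k) (r + l)
  p<q : p <ℚ q
  p<q = subst₂ _<ℚ_
    (trans (ℚ.+-assoc p (ℚ.- q) q) (trans (cong (p +ℚ_) (ℚ.+-inverseˡ q)) (ℚ.+-identityʳ p)))
    (ℚ.+-identityˡ q) (ℚ.+-monoˡ-< q h)
  ring : ∀ a n d → a * n * (1 * d) ≡ a * (n * d)
  ring = solve-∀

theorem3 : (n k l : ℕ) → 0 < k → n < 2 * l → k + l < n
    → ((1ℚ +ℚ ((n ∸ k) over (n ∸ 1))) *ℚ ((l ∸ 1) over (n ∸ 1))) <ℚ 1ℚ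
    → (((+ (n ∸ k)) /ℚ 1) *ℚ H (n ∸ l) (n ∸ 2)) -ℚ (((+ (n ∸ l)) /ℚ 1) *ℚ H k (n ∸ 2)) <ℚ 0ℚ
    → ((∀ (𝒜 ℬ : Family n) → Uniform k 𝒜 → Uniform l ℬ → CrossIntersecting 𝒜 ℬ
    → card 𝒜 * card ℬ ≤ ((n ∸ 1) C (k ∸ 1)) * ((n ∸ 1) C (l ∸ 1)))
    × (Σ (Family n) λ 𝒜 → Σ (Family n) λ ℬ → (Uniform k 𝒜 × Uniform l ℬ × CrossIntersecting 𝒜 ℬ
    × card 𝒜 * card ℬ ≡ ((n ∸ 1) C (k ∸ 1)) * ((n ∸ 1) C (l ∸ 1))))
    × (∀ (𝒜 ℬ : Family n) → Uniform k 𝒜 → Uniform l ℬ → CrossIntersecting 𝒜 ℬ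
    → card 𝒜 * card ℬ ≡ ((n ∸ 1) C (k ∸ 1)) * ((n ∸ 1) C (l ∸ 1))
    → CommonStar k l 𝒜 ℬ))
theorem3 n k l 0<k n<2l k+l<n h₁ h₂ with shape n k l 0<k n<2l k+l<n
... | k , l , r , refl , refl , refl , k<l , 0<r =
  proj₁ main ,
  (star (suc k) zero , star (suc l) zero ,
    sized-uniform (suc k) _ , sized-uniform (suc l) _ , stars-cross (suc k) (suc l) ,
    cong₂ _*_ (star-zero-card N k) (star-zero-card N l)) ,
  proj₂ main
  where
  N = suc (k + (l + r))
  rotate : ∀ k l r → suc (k + (l + r)) ≡ l + (suc k + r)
  rotate = solve-∀
  swap : ∀ k l r → k + (l + r) ≡ (k + r) + l
  swap = solve-∀
  n-k : N ∸ k ≡ suc l + r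
  n-k = trans (cong (_∸ k) (sym (+-suc k (l + r)))) (m+n∸m≡n k (suc (l + r)))
  n-l : N ∸ l ≡ suc k + r
  n-l = trans (cong (_∸ l) (rotate k l r)) (m+n∸m≡n l (suc k + r))
  -- With `l` one less than the set size, the sum runs from `k + r + 1` to `k + l + r` and so has
  -- `l` terms.
  harm-l : H (N ∸ l) (k + (l + r)) ≡ harmAux (suc (k + r)) l
  harm-l = trans (cong (λ m → H m (k + (l + r))) n-l)
    (cong (harmAux (suc (k + r))) (trans (cong (_∸ (k + r)) (swap k l r)) (m+n∸m≡n (k + r) l)))
  harm-k : H (suc k) (k + (l + r)) ≡ harmAux (suc k) (r + l)
  harm-k = cong (harmAux (suc k)) (trans (m+n∸m≡n k (l + r)) (+-comm l r))
  main = cross-intersecting-product k l r k<l 0<r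
    (first-condition k l r (subst (λ m → ((1ℚ +ℚ (m over N)) *ℚ (l over N)) <ℚ 1ℚ) n-k h₁))
    (square-condition k l r (second-condition k l r
      (subst₂ (λ x y → (x -ℚ y) <ℚ 0ℚ)
        (cong₂ (λ m x → ((+ m) /ℚ 1) *ℚ x) n-k harm-l)
        (cong₂ (λ m x → ((+ m) /ℚ 1) *ℚ x) n-l harm-k) h₂)))
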